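{- Let $k\geq 3$, $n_1,\dots,n_k\geq 2$, and let $K_{n_1,\dots,n_k}$ be the complete $k$-partite graph with parts $V_1,\dots,V_k$, $|V_i|=n_i$. Let $j$ be an index with $n_j=\min\{n_1,\dots,n_k\}$ and let $$f(k,n_j)=(n_j-1)(k-1)+\tfrac{(n_j-2)(n_j-1)}{2}-\tfrac{(k-2)(k-1)}{2}.$$ Let $G\in\mathcal{O}(K_{n_1,\dots,n_k})$ have the minimum number of edges among all graphs in $\mathcal{O}(K_{n_1,\dots,n_k})$, with split decomposition $Q_0,Q_1,\dots,Q_k$. Then: (1) If $k$ is even and $f(k,n_j)>0$, then $Q_0$ is complete and each $Q_i$ ($i\geq1$) is star-spoke (so $G$ is a multi-leaf repeater graph), and $|E(G)|=\frac{k(k-1)}{2}+\sum_{i=1}^k(n_i-1)$. (2) If $k$ is even and $f(k,n_j)<0$, then $Q_0$ is a star pointing towards $Q_j$, $Q_j$ is complete, all other $Q_i$ ($i\neq 0,j$) are star-spoke, and $|E(G)|=n_j(k-1)+\frac{n_j(n_j-1)}{2}+\sum_{i\neq j}(n_i-1)$. If $f(k,n_j)=0$, the graphs described in (1) and (2) have the same number of edges and both are minimal in the LC orbit. (3) If $k$ is odd, then $Q_0$ is a star pointing towards $Q_j$, $Q_j$ is star-center, all other $Q_i$ ($i\neq0,j$) are star-spoke, and $|E(G)|=n_j(k-1)+\sum_{i\neq j}(n_i-1)$.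
   Context: Local complement $c_v(G)$: replace the subgraph induced on the neighbourhood of $v$ by its complement, leaving all other edges unchanged; $\mathcal{O}(G)$ is the set of graphs on the same labeled vertex set obtainable from $G$ by finite sequences of local complements. Split decomposition of graphs in this orbit: every $G\in\mathcal{O}(K_{n_1,\dots,n_k})$ is described by quotient graphs $Q_0,Q_1,\dots,Q_k$, where $Q_i$ ($i\geq1$) has vertex set $V_i$ (leaf-nodes) plus one split-node $s_i$, $Q_0$ has $k$ split-nodes $t_1,\dots,t_k$, and each quotient graph is complete or a star. $G$ is reconstructed as follows: two vertices of $V_i$ are adjacent in $G$ iff adjacent in $Q_i$; $u\in V_i$, $v\in V_\ell$ ($i\neq\ell$) are adjacent in $G$ iff $u s_i\in E(Q_i)$, $t_it_\ell\in E(Q_0)$ and $s_\ell v\in E(Q_\ell)$. Terminology: $Q_i$ ($i\geq 1$) is complete; star-center if it is a star whose center is the split-node $s_i$; star-spoke if it is a star whose center is a leaf-node. $Q_0$ is complete, or a star "pointing towards $Q_j$" meaning a star with center $t_j$. A multi-leaf repeater graph is a complete graph $K_k$ on vertices $w_1,\dots,w_k$ with $n_i-1$ additional pendant leaves attached to $w_i$.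
   Formalization: In (2) and (3), Q_0 points towards some Q_{j'} with n_{j'} minimal, not necessarily the index j fixed in advance: with ties, e.g. K_{2,2,2}, symmetry refutes the literal claim. The parenthetical that G is a multi-leaf repeater graph is not restated. -}

module Defs where

open import Data.Nat using (ℕ; zero; suc; _+_; _*_; _∸_; _≤_; _<_)
open import Data.Nat.DivMod using (_/_; _%_)
open import Data.Nat.ListAction using (sum)
open import Data.Fin using (Fin; _≟_)
open import Data.Bool using (Bool; true; false; not; _∧_; _xor_; if_then_else_)
open import Data.Maybe using (Maybe; just; nothing)
open import Data.List using (List; []; _∷_; map; concatMap; allFin)
open import Data.Product using (Σ; _×_; _,_; ∃)
open import Data.Sum using (_⊎_)
open import Data.Product.Properties using (≡-dec)
open import Data.Integer as ℤ using (ℤ; +_)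
open import Relation.Nullary using (¬_; does)
open import Relation.Binary.PropositionalEquality using (_≡_; _≢_)

Vtx : (k : ℕ) → (Fin k → ℕ) → Set
Vtx k n = Σ (Fin k) (λ i → Fin (n i))

Graph : (k : ℕ) → (Fin k → ℕ) → Set
Graph k n = Vtx k n → Vtx k n → Bool

_≟V_ : ∀ {k n} → (u w : Vtx k n) → Relation.Nullary.Dec (u ≡ w)
_≟V_ = ≡-dec _≟_ _≟_

completeMultipartite : (k : ℕ) → (n : Fin k → ℕ) → Graph k n
completeMultipartite k n (i , _) (l , _) = not (does (i ≟ l))

localComp : ∀ {k n} → Vtx k n → Graph k n → Graph k n
localComp v G u w =
  if does (u ≟V w) then G u w else (G u w xor (G v u ∧ G v w))

lcSeq : ∀ {k n} → List (Vtx k n) → Graph k n → Graph k n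
lcSeq []       G = G
lcSeq (v ∷ vs) G = lcSeq vs (localComp v G)

InOrbit : ∀ {k n} → Graph k n → Graph k n → Set
InOrbit {k} {n} G H = Σ (List (Vtx k n)) λ vs → ∀ u w → H u w ≡ lcSeq vs G u w

allVtx : (k : ℕ) → (n : Fin k → ℕ) → List (Vtx k n)
allVtx k n = concatMap (λ i → map (λ a → (i , a)) (allFin (n i))) (allFin k)

b2n : Bool → ℕ
b2n true  = 1
b2n false = 0

numEdges : ∀ {k n} → Graph k n → ℕ
numEdges {k} {n} G =
  sum (concatMap (λ u → map (λ w → b2n (G u w)) (allVtx k n)) (allVtx k n)) / 2

MinInOrbit : ∀ {k n} → Graph k n → Graph k n → Set
MinInOrbit {k} {n} K G = InOrbit K G × (∀ H → InOrbit K H → numEdges G ≤ numEdges H)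

-- Quotient graphs.  A quotient graph on m leaf-nodes plus one split-node:
-- nodes are Maybe (Fin m), `nothing` being the split-node.

Node : ℕ → Set
Node m = Maybe (Fin m)

IsComplete : {A : Set} → (A → A → Bool) → Set
IsComplete {A} Q = ∀ (x y : A) → (Q x y ≡ true → x ≢ y) × (x ≢ y → Q x y ≡ true)

IsStarAt : {A : Set} → (A → A → Bool) → A → Set
IsStarAt {A} Q c = ∀ (x y : A) →
  (Q x y ≡ true → (x ≢ y × (x ≡ c ⊎ y ≡ c))) × ((x ≢ y × (x ≡ c ⊎ y ≡ c)) → Q x y ≡ true)

IsStar : {A : Set} → (A → A → Bool) → Set
IsStar {A} Q = Σ A λ c → IsStarAt Q c

StarCenter : ∀ {m} → (Node m → Node m → Bool) → Set
StarCenter Q = IsStarAt Q nothing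

StarSpoke : ∀ {m} → (Node m → Node m → Bool) → Set
StarSpoke {m} Q = Σ (Fin m) λ a → IsStarAt Q (just a)

record SplitDec (k : ℕ) (n : Fin k → ℕ) : Set where
  field
    Q₀ : Fin k → Fin k → Bool
    Q  : (i : Fin k) → Node (n i) → Node (n i) → Bool
open SplitDec public

ValidDec : ∀ {k n} → SplitDec k n → Set
ValidDec D = (IsComplete (Q₀ D) ⊎ IsStar (Q₀ D)) ×
             (∀ i → IsComplete (Q D i) ⊎ IsStar (Q D i))

Decomposes : ∀ {k n} → SplitDec k n → Graph k n → Set
Decomposes {k} {n} D G =
  (∀ i (a b : Fin (n i)) → G (i , a) (i , b) ≡ Q D i (just a) (just b)) ×
  (∀ i l (a : Fin (n i)) (b : Fin (n l)) → i ≢ l →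
     G (i , a) (l , b) ≡ (Q D i (just a) nothing ∧ Q₀ D i l ∧ Q D l nothing (just b)))

Shape1 : ∀ {k n} → SplitDec k n → Set
Shape1 D = IsComplete (Q₀ D) × (∀ i → StarSpoke (Q D i))

Shape2 : ∀ {k n} → Fin k → SplitDec k n → Set
Shape2 j D = IsStarAt (Q₀ D) j × IsComplete (Q D j) × (∀ i → i ≢ j → StarSpoke (Q D i))

Shape3 : ∀ {k n} → Fin k → SplitDec k n → Set
Shape3 j D = IsStarAt (Q₀ D) j × StarCenter (Q D j) × (∀ i → i ≢ j → StarSpoke (Q D i))

sumFin : ∀ {k} → (Fin k → ℕ) → ℕ
sumFin {k} g = sum (map g (allFin k))

sumOthers : ∀ {k} → (Fin k → ℕ) → Fin k → ℕ
sumOthers n j = sumFin (λ i → if does (i ≟ j) then 0 else n i ∸ 1)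

fkn : ℕ → ℕ → ℤ
fkn k m = (+ ((m ∸ 1) * (k ∸ 1) + ((m ∸ 2) * (m ∸ 1)) / 2)) ℤ.- (+ (((k ∸ 2) * (k ∸ 1)) / 2))

edges1 : (k : ℕ) → (Fin k → ℕ) → ℕ
edges1 k n = (k * (k ∸ 1)) / 2 + sumFin (λ i → n i ∸ 1)

edges2 : (k : ℕ) → (Fin k → ℕ) → Fin k → ℕ
edges2 k n j = n j * (k ∸ 1) + (n j * (n j ∸ 1)) / 2 + sumOthers n j

edges3 : (k : ℕ) → (Fin k → ℕ) → Fin k → ℕ
edges3 k n j = n j * (k ∸ 1) + sumOthers n j

IsMinIndex : ∀ {k} → (Fin k → ℕ) → Fin k → Set
IsMinIndex n j = ∀ i → n j ≤ n i

{-# OPTIONS --safe #-}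
module Submission where

-- Local complementation at a vertex complements locally the quotient graphs at the
-- nodes linked to that vertex, so each graph of the orbit is determined by the type
-- of Q₀ and the types of the Qᵢ.  Starting from the complete multipartite graph, the
-- number of star-spoke Qᵢ stays even, where for Q₀ a star pointing towards Qⱼ
-- a complete Qⱼ counts as well.  The edges are counted from the types.  Making every
-- Qᵢ (for a star Q₀: every Qᵢ with i ≠ j) star-spoke is cheapest, and every other
-- choice is dearer than the best allowed one; parity then leaves the complete Q₀ only
-- for even k and forces Qⱼ to be complete (k even) or star-center (k odd).  The sign
-- of f is the sign of the difference between the two candidates for even k.

open import Defs
open import Algebra using (CommutativeRing)
open import Data.Bool using (Bool; true; false; not; _∧_; _∨_; _xor_; if_then_else_)
import Data.Bool as Bool
open import Data.Bool.Properties
  using (xor-∧-commutativeRing; xor-identityʳ; xor-same; ∧-zeroʳ; ∧-conicalˡ; ∧-conicalʳ;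
         ∨-comm; not-involutive; not-distribˡ-xor; ¬-not)
open import Data.Fin using (Fin; zero; suc; _≟_; fromℕ<; punchIn)
open import Data.Fin.Properties using (any?; punchInᵢ≢i)
import Data.Integer as ℤ
import Data.Integer.Properties as ℤ
open import Data.List using (List; []; _∷_; _++_; [_]; map; concatMap; allFin; tabulate)
open import Data.List.Membership.Propositional using (_∈_)
open import Data.List.Membership.Propositional.Properties using (∈-allFin)
open import Data.List.Properties using (map-tabulate; map-∘; map-concatMap)
open import Data.List.Relation.Unary.Any using (here; there)
open import Data.Maybe using (Maybe; just; nothing; is-just)
import Data.Maybe as Maybe
open import Data.Maybe.Properties using (just-injective) renaming (≡-dec to Maybe-≡-dec)
open import Data.Nat
  using (ℕ; zero; suc; _+_; _*_; _∸_; _/_; _%_; _≤_; z≤n; s≤s; >-nonZero)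
import Data.Nat as ℕ
open import Data.Nat.Divisibility using (_∣_; divides; ∣m∣n⇒∣m+n; m∣m*n)
open import Data.Nat.DivMod using (m/n*n≡m; m*n/n≡m; /-monoˡ-≤)
open import Data.Nat.ListAction using () renaming (sum to sumᴸ)
open import Data.Nat.ListAction.Properties using (sum-++)
open import Data.Nat.Properties hiding (_≟_)
open import Data.Nat.Tactic.RingSolver using (solve-∀)
open import Data.Product using (Σ; ∃; ∃₂; _×_; _,_; proj₁; proj₂)
open import Data.Product.Properties using (,-injectiveˡ)
open import Data.Sum using (_⊎_; inj₁; inj₂)
open import Function using (_∘_; const)
open import Relation.Binary.Definitions using (DecidableEquality)
open import Relation.Binary.PropositionalEquality
  using (_≡_; _≢_; refl; sym; trans; cong; cong₂; subst; subst₂; ≢-sym; module ≡-Reasoning)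
open import Relation.Nullary using (Dec; yes; no; does; contradiction; ¬?; _×-dec_)
open import Relation.Nullary.Decidable using (dec-true; dec-false)
open import Algebra.Properties.CommutativeMonoid.Sum
  (CommutativeRing.+-commutativeMonoid xor-∧-commutativeRing)
  using () renaming (sum to xorSum; sum-cong-≗ to xorSum-cong; sum-remove to xorSum-remove;
                     sum-replicate-zero to xorSum-false)
open import Algebra.Properties.Semiring.Sum +-*-semiring
  using (sum; sum-cong-≗; sum-replicate-zero; ∑-distrib-+; ∑-comm;
         *-distribˡ-sum; *-distribʳ-sum)

-- Shapes of quotient graphs and local complementation

-- The theorem speaks of an arbitrary valid decomposition `D`, while following local complements
-- yields one particular decomposition. The two agree because no quotient graph has an isolated
-- node: each edge of Q₀ and each link of a leaf to its split-node extends to an edge of `G`, from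
-- which any other decomposition recovers it. The comparison of edge counts depends on Q₀. If Q₀ is
-- a star with centre tⱼ, every leaf of Vⱼ is linked to sⱼ, so each other Qᵢ contributes separately
-- and is compared with star-spoke by itself. If Q₀ is complete, the count contains the product d d′
-- of the numbers of linked leaves for every pair of parts; the estimate d + d′ ≤ d d′ + 1, sharp
-- when one of them is 1, replaces it by separate contributions. Parity may forbid the all-spoke
-- graph with the same Q₀, so a dear graph has to be compared with the best balanced graph, possibly
-- over the other kind of Q₀ or with a complete Qⱼ. The size of the smallest part enters there.

data Shape (A : Set) : Set where
  complete : Shape A
  star     : A → Shape A

module Quotient {A : Set} (_≟_ : DecidableEquality A) where

  ≟-refl : ∀ x → does (x ≟ x) ≡ true
  ≟-refl x = dec-true (x ≟ x) refl

  ≟-sym : ∀ x y → does (x ≟ y) ≡ does (y ≟ x)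
  ≟-sym x y with x ≟ y
  ... | yes refl = sym (≟-refl x)
  ... | no x≢y   = sym (dec-false (y ≟ x) (≢-sym x≢y))

  ⟦_⟧ : Shape A → A → A → Bool
  ⟦ complete ⟧ x y = not (does (x ≟ y))
  ⟦ star c   ⟧ x y = not (does (x ≟ y)) ∧ (does (x ≟ c) ∨ does (y ≟ c))

  ⟦⟧-irrefl : ∀ s x → ⟦ s ⟧ x x ≡ false
  ⟦⟧-irrefl complete x rewrite ≟-refl x = refl
  ⟦⟧-irrefl (star c) x rewrite ≟-refl x = refl

  ⟦⟧-sym : ∀ s x y → ⟦ s ⟧ x y ≡ ⟦ s ⟧ y x
  ⟦⟧-sym complete x y = cong not (≟-sym x y)
  ⟦⟧-sym (star c) x y =
    cong₂ _∧_ (cong not (≟-sym x y)) (∨-comm (does (x ≟ c)) (does (y ≟ c)))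

  ⟦star⟧-centre : ∀ c y → y ≢ c → ⟦ star c ⟧ c y ≡ true
  ⟦star⟧-centre c y y≢c rewrite dec-false (c ≟ y) (≢-sym y≢c) | ≟-refl c = refl

  lcShape : A → Shape A → Shape A
  lcShape v complete = star v
  lcShape v (star c) = if does (v ≟ c) then complete else star c

  -- A complete graph loses all edges outside `v`; a star complemented at its centre becomes
  -- complete; any other node of a star has one neighbour, so nothing changes. On the diagonal the
  -- xor formula would create loops at the neighbours of `v`, hence `x ≢ y`.
  lcShape-correct : ∀ v s x y → x ≢ y →
    ⟦ lcShape v s ⟧ x y ≡ ⟦ s ⟧ x y xor (⟦ s ⟧ v x ∧ ⟦ s ⟧ v y)
  lcShape-correct v complete x y x≢y
    rewrite dec-false (x ≟ y) x≢y | ≟-sym v x | ≟-sym v y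
    with does (x ≟ v) | does (y ≟ v)
  ... | true  | true  = refl
  ... | true  | false = refl
  ... | false | true  = refl
  ... | false | false = refl
  lcShape-correct v (star c) x y x≢y with v ≟ c
  ... | yes refl
    rewrite dec-false (x ≟ y) x≢y | ≟-sym v x | ≟-sym v y
    with does (x ≟ v) | does (y ≟ v)
  ...   | true  | true  = refl
  ...   | true  | false = refl
  ...   | false | true  = refl
  ...   | false | false = refl
  lcShape-correct v (star c) x y x≢y | no _ with x ≟ c | y ≟ c
  ... | yes refl | yes refl = contradiction refl x≢y
  ... | yes _ | no _
    rewrite ∧-zeroʳ (not (does (v ≟ y))) | ∧-zeroʳ (not (does (v ≟ x)) ∧ true) =
      sym (xor-identityʳ _)
  ... | no _ | _
    rewrite ∧-zeroʳ (not (does (v ≟ x))) = sym (xor-identityʳ _)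

  lcShape-if : ∀ g v s x y → x ≢ y →
    ⟦ (if g then lcShape v s else s) ⟧ x y ≡ ⟦ s ⟧ x y xor (g ∧ ⟦ s ⟧ v x ∧ ⟦ s ⟧ v y)
  lcShape-if true  v s x y x≢y = lcShape-correct v s x y x≢y
  lcShape-if false v s x y x≢y = sym (xor-identityʳ _)

_≟ᴺ_ : ∀ {m} → DecidableEquality (Node m)
_≟ᴺ_ = Maybe-≡-dec _≟_

module Root {k} = Quotient (_≟_ {k})
module Leaf {m} = Quotient (_≟ᴺ_ {m})
open Root using () renaming (⟦_⟧ to ⟦_⟧₀)
open Leaf using (⟦_⟧)

≟-refl : ∀ {m} (a : Fin m) → does (a ≟ a) ≡ true
≟-refl = Root.≟-refl

module _ {k : ℕ} {n : Fin k → ℕ} where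

  LeafShapes : Set
  LeafShapes = ∀ i → Shape (Node (n i))

  toDec : Shape (Fin k) → LeafShapes → SplitDec k n
  toDec r q = record { Q₀ = ⟦ r ⟧₀ ; Q = λ i → ⟦ q i ⟧ }

  Decomposes-resp : ∀ {r q q′} {G : Graph k n} → (∀ l → q l ≡ q′ l) →
    Decomposes (toDec r q) G → Decomposes (toDec r q′) G
  Decomposes-resp {r} q≗q′ (inner , outer) =
    (λ i a b → trans (inner i a b) (cong (λ s → ⟦ s ⟧ (just a) (just b)) (q≗q′ i))) ,
    (λ i l a b i≢l → trans (outer i l a b i≢l)
      (cong₂ (λ s s′ → ⟦ s ⟧ (just a) nothing ∧ ⟦ r ⟧₀ i l ∧ ⟦ s′ ⟧ nothing (just b))
        (q≗q′ i) (q≗q′ l)))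

  localComp-diag : ∀ v (G : Graph k n) u → localComp v G u u ≡ G u u
  localComp-diag v G u rewrite dec-true (u ≟V u) refl = refl

  localComp-≢ : ∀ v (G : Graph k n) {u w} → u ≢ w →
    localComp v G u w ≡ G u w xor (G v u ∧ G v w)
  localComp-≢ v G {u} {w} u≢w rewrite dec-false (u ≟V w) u≢w = refl

  -- A vertex of Vᵢ acts on another Qₗ only through the edges from the leaf to sᵢ and from tᵢ to tₗ,
  -- and there it acts as the split-node `nothing`. Matching on `refl` is needed because `just a`
  -- lives in `Node (n i)`.
  lcLeaf : Vtx k n → Shape (Fin k) → LeafShapes → LeafShapes
  lcLeaf (i , a) r q l with i ≟ l
  ... | yes refl = Leaf.lcShape (just a) (q i)
  ... | no _     =
    if ⟦ q i ⟧ (just a) nothing ∧ ⟦ r ⟧₀ i l then Leaf.lcShape nothing (q l) else q l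

  lcRoot : Vtx k n → Shape (Fin k) → LeafShapes → Shape (Fin k)
  lcRoot (i , a) r q = if ⟦ q i ⟧ (just a) nothing then Root.lcShape i r else r

  lcLeaf-same : ∀ i a r q → lcLeaf (i , a) r q i ≡ Leaf.lcShape (just a) (q i)
  lcLeaf-same i a r q with i ≟ i
  ... | yes refl = refl
  ... | no i≢i   = contradiction refl i≢i

  lcLeaf-other : ∀ i a r q l → i ≢ l → lcLeaf (i , a) r q l ≡
    (if ⟦ q i ⟧ (just a) nothing ∧ ⟦ r ⟧₀ i l then Leaf.lcShape nothing (q l) else q l)
  lcLeaf-other i a r q l i≢l with i ≟ l
  ... | yes i≡l = contradiction i≡l i≢l
  ... | no _    = refl

  module _ {r : Shape (Fin k)} {q : LeafShapes} {G : Graph k n}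
           (dec : Decomposes (toDec r q) G) (i : Fin k) (a : Fin (n i)) where
    private
      inner = proj₁ dec
      outer = proj₂ dec
      v : Vtx k n
      v = (i , a)
      r′ = lcRoot v r q
      q′ = lcLeaf v r q

      p : ∀ l → Fin (n l) → Bool
      p l b = ⟦ q l ⟧ (just b) nothing

      p′ : ∀ l → Fin (n l) → Bool
      p′ l b = ⟦ q′ l ⟧ (just b) nothing

      rootAdj : ∀ {l m} → l ≢ m →
        ⟦ r′ ⟧₀ l m ≡ ⟦ r ⟧₀ l m xor (p i a ∧ ⟦ r ⟧₀ i l ∧ ⟦ r ⟧₀ i m)
      rootAdj {l} {m} l≢m = Root.lcShape-if (p i a) i r l m l≢m

      -- A local complement at the split-node changes only pairs of its neighbours, and the
      -- split-node is not its own neighbour.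
      port-other : ∀ {l} → i ≢ l → ∀ b → p′ l b ≡ p l b
      port-other {l} i≢l b
        rewrite lcLeaf-other i a r q l i≢l
          | Leaf.lcShape-if (p i a ∧ ⟦ r ⟧₀ i l) nothing (q l) (just b) nothing (λ ())
          | Leaf.⟦⟧-irrefl (q l) nothing
          | ∧-zeroʳ (⟦ q l ⟧ nothing (just b))
          | ∧-zeroʳ (p i a ∧ ⟦ r ⟧₀ i l) = xor-identityʳ _

      port-same : ∀ b → p′ i b ≡ p i b xor (⟦ q i ⟧ (just a) (just b) ∧ p i a)
      port-same b rewrite lcLeaf-same i a r q =
        Leaf.lcShape-correct (just a) (q i) (just b) nothing λ ()

      outer′ : ∀ {l m} → l ≢ m → ∀ b c → G (l , b) (m , c) ≡ p l b ∧ ⟦ r ⟧₀ l m ∧ p m c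
      outer′ {l} {m} l≢m b c = trans (outer l m b c l≢m)
        (cong (λ z → p l b ∧ ⟦ r ⟧₀ l m ∧ z) (Leaf.⟦⟧-sym (q m) nothing (just c)))

      inner-lc : ∀ l b c → localComp v G (l , b) (l , c) ≡ ⟦ q′ l ⟧ (just b) (just c)
      inner-lc l b c with b ≟ c
      ... | yes refl = trans (localComp-diag v G (l , b)) (trans (inner l b b)
            (trans (Leaf.⟦⟧-irrefl (q l) (just b)) (sym (Leaf.⟦⟧-irrefl (q′ l) (just b)))))
      ... | no b≢c = trans (localComp-≢ v G λ { refl → b≢c refl }) (step (i ≟ l))
        where
        step : Dec (i ≡ l) →
          G (l , b) (l , c) xor (G v (l , b) ∧ G v (l , c)) ≡ ⟦ q′ l ⟧ (just b) (just c)
        step (yes refl) rewrite lcLeaf-same i a r q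
          | Leaf.lcShape-correct (just a) (q i) (just b) (just c) (b≢c ∘ just-injective)
          | inner i b c | inner i a b | inner i a c = refl
        step (no i≢l) rewrite lcLeaf-other i a r q l i≢l
          | Leaf.lcShape-if (p i a ∧ ⟦ r ⟧₀ i l) nothing (q l) (just b) (just c)
              (b≢c ∘ just-injective)
          | inner l b c | outer i l a b i≢l | outer i l a c i≢l =
          factor (p i a) (⟦ r ⟧₀ i l) _ _ (⟦ q l ⟧ (just b) (just c))
          where
          factor : ∀ g e x y z →
            z xor ((g ∧ e ∧ x) ∧ (g ∧ e ∧ y)) ≡ z xor ((g ∧ e) ∧ x ∧ y)
          factor false _     _ _ _ = refl
          factor true  false _ _ _ = refl
          factor true  true  _ _ _ = refl

      -- Only one of the three factors changes. If `v` lies in the part of one endpoint, it is the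
      -- link of that endpoint to its split-node, since edges at tᵢ survive a local complement at
      -- tᵢ. Otherwise both links survive and the change is that of Q₀.
      outer-lc : ∀ l m b c → l ≢ m → localComp v G (l , b) (m , c) ≡
        p′ l b ∧ ⟦ r′ ⟧₀ l m ∧ p′ m c
      outer-lc l m b c l≢m =
        trans (localComp-≢ v G (l≢m ∘ ,-injectiveˡ)) (step (i ≟ l) (i ≟ m))
        where
        step : Dec (i ≡ l) → Dec (i ≡ m) →
          G (l , b) (m , c) xor (G v (l , b) ∧ G v (m , c)) ≡ p′ l b ∧ ⟦ r′ ⟧₀ l m ∧ p′ m c
        step (yes refl) (yes refl) = contradiction refl l≢m
        step (yes refl) (no i≢m)
          rewrite rootAdj l≢m | port-same b | port-other i≢m c | Root.⟦⟧-irrefl r i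
            | outer′ i≢m b c | inner i a b | outer′ i≢m a c =
          factor (p i a) (p i b) (⟦ r ⟧₀ i m) _ _
          where
          factor : ∀ g x e z y → (x ∧ e ∧ y) xor (z ∧ g ∧ e ∧ y) ≡
            (x xor (z ∧ g)) ∧ (e xor (g ∧ false)) ∧ y
          factor false false _     false _ = refl
          factor false false _     true  _ = refl
          factor false true  false false _ = refl
          factor false true  true  false y = xor-identityʳ y
          factor false true  false true  _ = refl
          factor false true  true  true  y = xor-identityʳ y
          factor true  false false false _ = refl
          factor true  false true  false _ = refl
          factor true  false false true  _ = refl
          factor true  false true  true  _ = refl
          factor true  true  false false _ = refl
          factor true  true  true  false y = xor-identityʳ y
          factor true  true  false true  _ = refl
          factor true  true  true  true  y = xor-same y
        step (no i≢l) (yes refl)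
          rewrite rootAdj l≢m | port-same c | port-other i≢l b | Root.⟦⟧-irrefl r i
            | outer′ l≢m b c | inner i a c | outer′ i≢l a b | Root.⟦⟧-sym r l i =
          factor (p i a) (p l b) (⟦ r ⟧₀ i l) _ _
          where
          factor : ∀ g x e z y → (x ∧ e ∧ y) xor ((g ∧ e ∧ x) ∧ z) ≡
            x ∧ (e xor (g ∧ e ∧ false)) ∧ (y xor (z ∧ g))
          factor false false _     _     _ = refl
          factor false true  false _     _ = refl
          factor false true  true  false _ = refl
          factor false true  true  true  _ = refl
          factor true  false false _     _ = refl
          factor true  false true  _     _ = refl
          factor true  true  false _     _ = refl
          factor true  true  true  false _ = refl
          factor true  true  true  true  _ = refl
        step (no i≢l) (no i≢m)
          rewrite rootAdj l≢m | port-other i≢l b | port-other i≢m c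
            | outer′ l≢m b c | outer′ i≢l a b | outer′ i≢m a c =
          factor (p i a) (p l b) (⟦ r ⟧₀ i l) (⟦ r ⟧₀ i m) _ _
          where
          factor : ∀ g x e f z y → (x ∧ z ∧ y) xor ((g ∧ e ∧ x) ∧ g ∧ f ∧ y) ≡
            x ∧ (z xor (g ∧ e ∧ f)) ∧ y
          factor false false _     _     _     _ = refl
          factor false true  _     _     false _ = refl
          factor false true  _     _     true  y = xor-identityʳ y
          factor true  false false _     _     _ = refl
          factor true  false true  _     _     _ = refl
          factor true  true  false _     false _ = refl
          factor true  true  false _     true  y = xor-identityʳ y
          factor true  true  true  false false _ = refl
          factor true  true  true  false true  y = xor-identityʳ y
          factor true  true  true  true  false _ = refl
          factor true  true  true  true  true  y = xor-same y

    localComp-decomposes : Decomposes (toDec r′ q′) (localComp v G)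
    localComp-decomposes = inner-lc , λ l m b c l≢m → trans (outer-lc l m b c l≢m)
      (cong (λ z → p′ l b ∧ ⟦ r′ ⟧₀ l m ∧ z) (Leaf.⟦⟧-sym (q′ m) (just c) nothing))

-- The orbit of the complete multipartite graph

data Role : Set where
  free centre spoke : Role

role : ∀ {k} → Maybe (Fin k) → Fin k → Role
role nothing  _ = free
role (just j) l = if does (l ≟ j) then centre else spoke

-- A graph of the orbit is encoded by r and t: r is the centre of the star Q₀
-- (nothing if Q₀ is complete) and t i is the leaf-node at the centre of the star
-- Qᵢ, if any.  The exception is Qⱼ for a star Q₀ with centre j: it is a star with
-- centre sⱼ when t j is nothing and complete otherwise, whatever the leaf in t j.
rootShape : ∀ {k} → Maybe (Fin k) → Shape (Fin k)
rootShape nothing  = complete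
rootShape (just j) = star j

-- Each role admits only two of the three types. The third would join a complete graph to a complete
-- Q₀, or the centre of one star to a spoke of the other, and the two quotient graphs would merge
-- into a single complete graph or star. The steps below never lead out of the two types.
quotient : ∀ {m} → Role → Maybe (Fin m) → Shape (Node m)
quotient free   nothing  = star nothing
quotient free   (just a) = star (just a)
quotient centre nothing  = star nothing
quotient centre (just _) = complete
quotient spoke  nothing  = complete
quotient spoke  (just a) = star (just a)

role-centre : ∀ {k} (j : Fin k) → role (just j) j ≡ centre
role-centre j rewrite ≟-refl j = refl

role-spoke : ∀ {k} {j l : Fin k} → l ≢ j → role (just j) l ≡ spoke
role-spoke {j = j} {l} l≢j rewrite dec-false (l ≟ j) l≢j = refl

-- In the roles `free` and `spoke` this is adjacency of the leaf to the split-node (`link-hit`,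
-- `link-miss`); in the role `centre` every leaf is adjacent to it (`link-centre`).
Hits : ∀ {m} → Fin m → Maybe (Fin m) → Set
Hits a t = t ≡ nothing ⊎ t ≡ just a

toggle : ∀ {m} → Fin m → Maybe (Fin m) → Maybe (Fin m)
toggle a nothing  = just a
toggle a (just _) = nothing

parity : ∀ {k} {n : Fin k → ℕ} → (∀ i → Maybe (Fin (n i))) → Bool
parity t = xorSum (is-just ∘ t)

parity-cong : ∀ {k} {n : Fin k → ℕ} {t t′ : ∀ i → Maybe (Fin (n i))} →
  (∀ i → is-just (t i) ≡ is-just (t′ i)) → parity t ≡ parity t′
parity-cong t≗t′ = xorSum-cong t≗t′

xorSum-flip : ∀ {k} {f g : Fin k → Bool} i → g i ≡ not (f i) →
  (∀ l → l ≢ i → g l ≡ f l) → xorSum g ≡ not (xorSum f)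
xorSum-flip {suc k} {f} {g} i gᵢ g≗f = trans (xorSum-remove {i = i} g)
  (trans (cong₂ _xor_ gᵢ (xorSum-cong λ l → g≗f (punchIn i l) (punchInᵢ≢i i l)))
  (trans (sym (not-distribˡ-xor (f i) _)) (cong not (sym (xorSum-remove {i = i} f)))))

xorSum-true : ∀ k → xorSum {k} (const true) ≡ (does (k % 2 ℕ.≟ 1))
xorSum-true zero = refl
xorSum-true (suc zero) = refl
xorSum-true (suc (suc k)) = trans (not-involutive _) (xorSum-true k)

module _ {k : ℕ} {n : Fin k → ℕ} where

  Centres : Set
  Centres = ∀ i → Maybe (Fin (n i))

  infixl 6 _[_≔_]
  _[_≔_] : Centres → (i : Fin k) → Maybe (Fin (n i)) → Centres
  (t [ i ≔ x ]) l with i ≟ l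
  ... | yes refl = x
  ... | no _     = t l

  ≔-same : ∀ (t : Centres) i x → (t [ i ≔ x ]) i ≡ x
  ≔-same t i x with i ≟ i
  ... | yes refl = refl
  ... | no i≢i   = contradiction refl i≢i

  ≔-other : ∀ (t : Centres) i x {l} → i ≢ l → (t [ i ≔ x ]) l ≡ t l
  ≔-other t i x {l} i≢l with i ≟ l
  ... | yes i≡l = contradiction i≡l i≢l
  ... | no _    = refl

  leaves : Maybe (Fin k) → Centres → LeafShapes {n = n}
  leaves r t i = quotient (role r i) (t i)

  realize : Maybe (Fin k) → Centres → SplitDec k n
  realize r t = toDec (rootShape r) (leaves r t)

  -- The transitions of the encoding under a local complement. The convention for the role `centre`
  -- is chosen so that `enter` keeps `t` although the shapes change, and `leave` at most renames a
  -- leaf. Only `switch` changes which entries are `just`, and it does so at two places at once,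
  -- which is why `parity` is invariant.
  data Step : Vtx k n → Maybe (Fin k) → Centres → Maybe (Fin k) → Centres → Set where
    enter : ∀ {i a t} → Hits a (t i) → Step (i , a) nothing t (just i) t
    leave : ∀ {i a t} →
      Step (i , a) (just i) t nothing (t [ i ≔ Maybe.map (const a) (t i) ])
    -- Any leaf `z` serves, because `quotient centre` ignores the leaf under `just`.
    switch : ∀ {i a j t} (z : Fin (n j)) → i ≢ j → Hits a (t i) → Step (i , a) (just j) t
      (just j) (t [ i ≔ toggle a (t i) ] [ j ≔ toggle z (t j) ])
    miss : ∀ {i a b r t} → t i ≡ just b → a ≢ b → r ≢ just i → Step (i , a) r t r t

  step-parity : ∀ {v r t r′ t′} → Step v r t r′ t′ → parity t′ ≡ parity t
  step-parity (enter _) = refl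
  step-parity {t = t} (leave {i} {a}) = parity-cong pointwise
    where
    pointwise : ∀ l → is-just ((t [ i ≔ Maybe.map (const a) (t i) ]) l) ≡ is-just (t l)
    pointwise l with i ≟ l
    ... | no _ = refl
    ... | yes refl with t l
    ...   | just _  = refl
    ...   | nothing = refl
  step-parity {t = t} (switch {i} {a} {j} z i≢j _) =
    trans (xorSum-flip j (toggled z _ (≔-same t₁ j _) tⱼ)
      (λ l l≢j → cong is-just (≔-other t₁ j _ (≢-sym l≢j))))
    (trans (cong not (xorSum-flip i (toggled a _ (≔-same t i _) refl)
      (λ l l≢i → cong is-just (≔-other t i _ (≢-sym l≢i))))) (not-involutive _))
    where
    t₁ = t [ i ≔ toggle a (t i) ]
    tⱼ : t j ≡ t₁ j
    tⱼ = sym (≔-other t i _ i≢j)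
    toggled : ∀ {m} (b : Fin m) x {y x′} → y ≡ toggle b x → x ≡ x′ →
      is-just y ≡ not (is-just x′)
    toggled b nothing  refl refl = refl
    toggled b (just _) refl refl = refl
  step-parity (miss _ _ _) = refl

  step-total : (∀ i → Fin (n i)) → ∀ v r t → ∃₂ (Step v r t)
  step-total z (i , a) r t with hits? (t i)
    where
    hits? : ∀ x → Hits a x ⊎ ∃ λ b → x ≡ just b × a ≢ b
    hits? nothing = inj₁ (inj₁ refl)
    hits? (just b) with a ≟ b
    ... | yes refl = inj₁ (inj₂ refl)
    ... | no a≢b   = inj₂ (b , refl , a≢b)
  step-total z (i , a) nothing t | inj₁ h = _ , _ , enter h
  step-total z (i , a) nothing t | inj₂ (_ , tᵢ , a≢b) = _ , _ , miss tᵢ a≢b λ ()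
  step-total z (i , a) (just j) t | h with i ≟ j
  ... | yes refl = _ , _ , leave
  step-total z (i , a) (just j) t | inj₁ h | no i≢j = _ , _ , switch (z j) i≢j h
  step-total z (i , a) (just j) t | inj₂ (_ , tᵢ , a≢b) | no i≢j =
    _ , _ , miss tᵢ a≢b (≢-sym i≢j ∘ just-injective)

  link-hit : ∀ ρ {m} {a : Fin m} {x} → Hits a x → ⟦ quotient ρ x ⟧ (just a) nothing ≡ true
  link-hit free   (inj₁ refl) = refl
  link-hit centre (inj₁ refl) = refl
  link-hit spoke  (inj₁ refl) = refl
  link-hit free   {a = a} (inj₂ refl) rewrite ≟-refl a = refl
  link-hit centre (inj₂ refl) = refl
  link-hit spoke  {a = a} (inj₂ refl) rewrite ≟-refl a = refl

  link-centre : ∀ {m} (a : Fin m) x → ⟦ quotient centre x ⟧ (just a) nothing ≡ true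
  link-centre a nothing  = refl
  link-centre a (just _) = refl

  link-miss : ∀ ρ {m} {a b : Fin m} → ρ ≢ centre → a ≢ b →
    ⟦ quotient ρ (just b) ⟧ (just a) nothing ≡ false
  link-miss free {a = a} {b} _ a≢b rewrite dec-false (a ≟ b) a≢b = refl
  link-miss spoke {a = a} {b} _ a≢b rewrite dec-false (a ≟ b) a≢b = refl
  link-miss centre ρ≢centre _ = contradiction refl ρ≢centre

  role≢centre : ∀ {r : Maybe (Fin k)} {i} → r ≢ just i → role r i ≢ centre
  role≢centre {nothing} _ ()
  role≢centre {just j} {i} r≢i with i ≟ j
  ... | yes refl = contradiction refl r≢i
  ... | no _     = λ ()

  step-root : ∀ {v r t r′ t′} → Step v r t r′ t′ →
    lcRoot v (rootShape r) (leaves r t) ≡ rootShape r′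
  step-root (enter h) rewrite link-hit free h = refl
  step-root {t = t} (leave {i} {a})
    rewrite role-centre i | link-centre a (t i) | ≟-refl i = refl
  step-root (switch {i} {a} {j} {t} z i≢j h)
    rewrite role-spoke i≢j | link-hit spoke h | dec-false (i ≟ j) i≢j = refl
  step-root {r = r} (miss {i} tᵢ a≢b r≢i)
    rewrite tᵢ | link-miss (role r i) (role≢centre r≢i) a≢b = refl

  step-leaf-same : ∀ {i a r t r′ t′} → Step (i , a) r t r′ t′ →
    Leaf.lcShape (just a) (leaves r t i) ≡ leaves r′ t′ i
  step-leaf-same {i} {a} {t = t} (enter h) rewrite role-centre i with t i | h
  ... | nothing | _ = refl
  ... | just _  | inj₂ refl rewrite ≟-refl a = refl
  step-leaf-same {i} {a} {t = t} leave
    rewrite role-centre i | ≔-same t i (Maybe.map (const a) (t i)) with t i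
  ... | nothing = refl
  ... | just _  = refl
  step-leaf-same {i} {a} {t = t} (switch {j = j} z i≢j h)
    rewrite role-spoke i≢j
      | ≔-other (t [ i ≔ toggle a (t i) ]) j (toggle z (t j)) (≢-sym i≢j)
      | ≔-same t i (toggle a (t i)) with t i | h
  ... | nothing | _ = refl
  ... | just _  | inj₂ refl rewrite ≟-refl a = refl
  step-leaf-same {i} {a} {r} (miss tᵢ a≢b r≢i) rewrite tᵢ with role r i | role≢centre r≢i
  ... | free   | _ rewrite dec-false (a ≟ _) a≢b = refl
  ... | spoke  | _ rewrite dec-false (a ≟ _) a≢b = refl
  ... | centre | ρ≢centre = contradiction refl ρ≢centre

  step-leaf-other : ∀ {i a r t r′ t′ l} → i ≢ l → Step (i , a) r t r′ t′ →
    (if ⟦ leaves r t i ⟧ (just a) nothing ∧ ⟦ rootShape r ⟧₀ i l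
      then Leaf.lcShape nothing (leaves r t l) else leaves r t l) ≡ leaves r′ t′ l
  step-leaf-other {i} {a} {t = t} {l = l} i≢l (enter h)
    rewrite link-hit free h | dec-false (i ≟ l) i≢l | role-spoke (≢-sym i≢l) with t l
  ... | nothing = refl
  ... | just _  = refl
  step-leaf-other {i} {a} {t = t} {l = l} i≢l leave
    rewrite role-centre i | link-centre a (t i) | Root.⟦star⟧-centre i l (≢-sym i≢l)
      | role-spoke (≢-sym i≢l) | ≔-other t i (Maybe.map (const a) (t i)) i≢l with t l
  ... | nothing = refl
  ... | just _  = refl
  step-leaf-other {i} {a} {t = t} {l = l} i≢l (switch {j = j} z i≢j h)
    rewrite role-spoke i≢j | link-hit spoke h with l ≟ j
  ... | yes refl
    rewrite dec-false (i ≟ l) i≢l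
      | ≔-same (t [ i ≔ toggle a (t i) ]) l (toggle z (t l)) with t l
  ...   | nothing = refl
  ...   | just _  = refl
  step-leaf-other {i} {a} {t = t} {l = l} i≢l (switch {j = j} z i≢j h) | no l≢j
    rewrite dec-false (i ≟ l) i≢l | dec-false (i ≟ j) i≢j
      | ≔-other (t [ i ≔ toggle a (t i) ]) j (toggle z (t j)) (≢-sym l≢j)
      | ≔-other t i (toggle a (t i)) i≢l = refl
  step-leaf-other {i} {r = r} i≢l (miss tᵢ a≢b r≢i)
    rewrite tᵢ | link-miss (role r i) (role≢centre r≢i) a≢b = refl

  step-decomposes : ∀ {v r t r′ t′ G} → Step v r t r′ t′ →
    Decomposes (realize r t) G → Decomposes (realize r′ t′) (localComp v G)
  step-decomposes {i , a} {r} {t} {r′} {t′} {G} s dec =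
    Decomposes-resp {r = rootShape r′} pointwise
      (subst (λ ρ → Decomposes (toDec ρ (lcLeaf (i , a) (rootShape r) (leaves r t)))
                               (localComp (i , a) G))
        (step-root s) (localComp-decomposes {r = rootShape r} dec i a))
    where
    pointwise : ∀ l → lcLeaf (i , a) (rootShape r) (leaves r t) l ≡ leaves r′ t′ l
    pointwise l with i ≟ l
    ... | yes refl = step-leaf-same s
    ... | no i≢l   = step-leaf-other i≢l s

  Balanced : Centres → Set
  Balanced t = parity t ≡ false

  Described : Graph k n → Set
  Described G = ∃₂ λ r t → Balanced t × Decomposes (realize r t) G

  lcSeq-described : (∀ i → Fin (n i)) → ∀ vs {G} → Described G → Described (lcSeq vs G)
  lcSeq-described z [] d = d
  lcSeq-described z (v ∷ vs) (r , t , bal , dec) with step-total z v r t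
  ... | r′ , t′ , s = lcSeq-described z vs
    (r′ , t′ , trans (step-parity s) bal , step-decomposes s dec)

  unsplit : Centres
  unsplit _ = nothing

  completeMultipartite-decomposes :
    Decomposes (realize nothing unsplit) (completeMultipartite k n)
  completeMultipartite-decomposes =
    (λ i a b → trans (cong not (≟-refl i)) (sym (∧-zeroʳ _))) ,
    (λ i l a b i≢l → trans (cong not (dec-false (i ≟ l) i≢l))
      (sym (cong (λ z → not z ∧ true) (dec-false (i ≟ l) i≢l))))

  orbit-described : (∀ i → Fin (n i)) → ∀ {G} →
    InOrbit (completeMultipartite k n) G → Described G
  orbit-described z (vs , G≗) with lcSeq-described z vs
    (nothing , unsplit , xorSum-false k , completeMultipartite-decomposes)
  ... | r , t , bal , inner , outer = r , t , bal ,
    (λ i a b → trans (G≗ _ _) (inner i a b)) ,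
    (λ i l a b i≢l → trans (G≗ _ _) (outer i l a b i≢l))

  -- Reaching the candidate graphs from the complete multipartite graph

  Reached : Maybe (Fin k) → Centres → Set
  Reached r t = Σ (Graph k n) λ G →
    InOrbit (completeMultipartite k n) G × Balanced t × Decomposes (realize r t) G

  -- `lcSeq` applies the head of the list first, so a further move on a reached graph goes at the
  -- end.
  lcSeq-snoc : ∀ vs v (G : Graph k n) → lcSeq (vs ++ [ v ]) G ≡ localComp v (lcSeq vs G)
  lcSeq-snoc []       v G = refl
  lcSeq-snoc (w ∷ vs) v G = lcSeq-snoc vs v (localComp w G)

  localComp-cong : ∀ v {G H : Graph k n} → (∀ u w → G u w ≡ H u w) →
    ∀ u w → localComp v G u w ≡ localComp v H u w
  localComp-cong v G≗H u w rewrite G≗H u w | G≗H v u | G≗H v w = refl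

  reached-start : Reached nothing unsplit
  reached-start = completeMultipartite k n , ([] , λ _ _ → refl) , xorSum-false k ,
    completeMultipartite-decomposes

  reached-step : ∀ {v r t r′ t′} → Step v r t r′ t′ → Reached r t → Reached r′ t′
  reached-step {v} s (G , (vs , G≗) , bal , dec) = localComp v G ,
    (vs ++ [ v ] , λ u w → trans (localComp-cong v G≗ u w)
      (cong (λ H → H u w) (sym (lcSeq-snoc vs v (completeMultipartite k n))))) ,
    trans (step-parity s) bal , step-decomposes s dec

  -- The state of the centre j is left open; balance determines it afterwards.
  reached-spokes : (∀ i → Fin (n i)) → ∀ j (ls : List (Fin k)) → ∃ λ t →
    Reached (just j) t × (∀ l → l ∈ ls → l ≢ j → is-just (t l) ≡ true)
  reached-spokes z j [] = unsplit , reached-step (enter {a = z j} (inj₁ refl)) reached-start ,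
    λ _ ()
  reached-spokes z j (i ∷ ls) with reached-spokes z j ls
  ... | t , R , spokes with i ≟ j
  ... | yes refl = t , R , λ where
    l (here refl) l≢j → contradiction refl l≢j
    l (there l∈)  l≢j → spokes l l∈ l≢j
  ... | no i≢j with t i in tᵢ
  ...   | just _  = t , R , λ where
    l (here refl) l≢j → cong is-just tᵢ
    l (there l∈)  l≢j → spokes l l∈ l≢j
  ...   | nothing = t [ i ≔ toggle (z i) (t i) ] [ j ≔ toggle (z j) (t j) ] ,
    reached-step (switch {a = z i} (z j) i≢j (inj₁ tᵢ)) R , updated
    where
    updated : ∀ l → l ∈ i ∷ ls → l ≢ j →
      is-just ((t [ i ≔ toggle (z i) (t i) ] [ j ≔ toggle (z j) (t j) ]) l) ≡ true
    updated l l∈ l≢j rewrite ≔-other (t [ i ≔ toggle (z i) (t i) ]) j (toggle (z j) (t j)) (≢-sym l≢j)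
      with i ≟ l | l∈
    ... | yes refl | _ rewrite tᵢ = refl
    ... | no i≢l   | here refl = contradiction refl i≢l
    ... | no i≢l   | there l∈′ = spokes l l∈′ l≢j

  AllSpokes : Fin k → Centres → Set
  AllSpokes j t = ∀ l → l ≢ j → is-just (t l) ≡ true

  -- The number of `just` entries is k or k - 1, depending on the entry at `j`. In a balanced
  -- encoding the parity of k therefore decides that entry.
  parity-spokes : ∀ {j t} → AllSpokes j t →
    parity t ≡ (if is-just (t j) then does (k % 2 ℕ.≟ 1) else not (does (k % 2 ℕ.≟ 1)))
  parity-spokes {j} {t} spokes with is-just (t j) in tⱼ
  ... | true = trans (xorSum-cong all) (xorSum-true k)
    where
    all : ∀ l → is-just (t l) ≡ true
    all l with l ≟ j
    ... | yes refl = tⱼ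
    ... | no l≢j   = spokes l l≢j
  ... | false = trans (xorSum-flip j tⱼ spokes) (cong not (xorSum-true k))

  balanced-even : ∀ {j t} → k % 2 ≡ 0 → AllSpokes j t → Balanced t → is-just (t j) ≡ true
  balanced-even {j} {t} even spokes bal with is-just (t j) | parity-spokes spokes
  ... | true  | _ = refl
  ... | false | eq rewrite even = contradiction (trans (sym eq) bal) λ ()

  balanced-odd : ∀ {j t} → k % 2 ≡ 1 → AllSpokes j t → Balanced t → is-just (t j) ≡ false
  balanced-odd {j} {t} odd spokes bal with is-just (t j) | parity-spokes spokes
  ... | false | _ = refl
  ... | true  | eq rewrite odd = contradiction (trans (sym eq) bal) λ ()

  reached-star : (∀ i → Fin (n i)) → ∀ j → ∃ λ t → Reached (just j) t × AllSpokes j t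
  reached-star z j with reached-spokes z j (allFin k)
  ... | t , R , spokes = t , R , λ l → spokes l (∈-allFin l)

  -- For even k, balance makes Qⱼ complete once all other parts are spokes of a star Q₀. A local
  -- complement at a leaf of Vⱼ then makes Q₀ complete and Qⱼ star-spoke, and the remaining stars
  -- are unchanged because their split-nodes are not their centres.
  reached-complete : (∀ i → Fin (n i)) → Fin k → k % 2 ≡ 0 →
    ∃ λ t → Reached nothing t × (∀ l → is-just (t l) ≡ true)
  reached-complete z j even with reached-star z j
  ... | t , R@(_ , _ , bal , _) , spokes =
    _ , reached-step (leave {a = z j}) R , all
    where
    all : ∀ l → is-just ((t [ j ≔ Maybe.map (const (z j)) (t j) ]) l) ≡ true
    all l with j ≟ l
    ... | no j≢l   = spokes l (≢-sym j≢l)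
    ... | yes refl with t j | balanced-even even spokes bal
    ...   | just _ | _ = refl

-- Uniqueness of the decomposition

module _ {A : Set} (_≟_ : DecidableEquality A) where
  open Quotient _≟_ using () renaming (⟦_⟧ to ⟦_⟧ᴬ)

  ⟦complete⟧-IsComplete : IsComplete ⟦ complete ⟧ᴬ
  ⟦complete⟧-IsComplete x y with x ≟ y
  ... | yes refl = (λ ()) , λ x≢x → contradiction refl x≢x
  ... | no x≢y   = (λ _ → x≢y) , λ _ → refl

  ⟦star⟧-IsStarAt : ∀ c → IsStarAt ⟦ star c ⟧ᴬ c
  ⟦star⟧-IsStarAt c x y with x ≟ y | x ≟ c | y ≟ c
  ... | yes refl | _       | _       = (λ ()) , λ (x≢x , _) → contradiction refl x≢x
  ... | no x≢y   | yes x≡c | _       = (λ _ → x≢y , inj₁ x≡c) , λ _ → refl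
  ... | no x≢y   | no _    | yes y≡c = (λ _ → x≢y , inj₂ y≡c) , λ _ → refl
  ... | no _     | no x≢c  | no y≢c  = (λ ()) , λ where
    (_ , inj₁ x≡c) → contradiction x≡c x≢c
    (_ , inj₂ y≡c) → contradiction y≡c y≢c

  ⟦⟧-valid : ∀ s → IsComplete ⟦ s ⟧ᴬ ⊎ IsStar ⟦ s ⟧ᴬ
  ⟦⟧-valid complete = inj₁ ⟦complete⟧-IsComplete
  ⟦⟧-valid (star c) = inj₂ (c , ⟦star⟧-IsStarAt c)

≡true-ext : ∀ {x y} → (x ≡ true → y ≡ true) → (y ≡ true → x ≡ true) → x ≡ y
≡true-ext {true}  {_}     f g = sym (f refl)
≡true-ext {false} {true}  f g = g refl
≡true-ext {false} {false} f g = refl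

module _ {A : Set} {Q : A → A → Bool} where

  valid-≢ : IsComplete Q ⊎ IsStar Q → ∀ {x y} → Q x y ≡ true → x ≢ y
  valid-≢ (inj₁ comp) e = proj₁ (comp _ _) e
  valid-≢ (inj₂ (_ , st)) e = proj₁ (proj₁ (st _ _) e)

  valid-symᵗ : IsComplete Q ⊎ IsStar Q → ∀ {x y} → Q x y ≡ true → Q y x ≡ true
  valid-symᵗ (inj₁ comp) e = proj₂ (comp _ _) (≢-sym (proj₁ (comp _ _) e))
  valid-symᵗ (inj₂ (_ , st)) e with proj₁ (st _ _) e
  ... | x≢y , inj₁ x≡c = proj₂ (st _ _) (≢-sym x≢y , inj₂ x≡c)
  ... | x≢y , inj₂ y≡c = proj₂ (st _ _) (≢-sym x≢y , inj₁ y≡c)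

  valid-neighbour : DecidableEquality A → IsComplete Q ⊎ IsStar Q →
    ∀ {x y} → y ≢ x → ∃ λ z → Q x z ≡ true
  valid-neighbour _ (inj₁ comp) {y = y} y≢x = y , proj₂ (comp _ _) (≢-sym y≢x)
  valid-neighbour _≟_ (inj₂ (c , st)) {x} {y} y≢x with x ≟ c
  ... | yes x≡c = y , proj₂ (st _ _) (≢-sym y≢x , inj₁ x≡c)
  ... | no x≢c  = c , proj₂ (st _ _) (x≢c , inj₂ refl)

IsComplete-resp : ∀ {A : Set} {Q Q′ : A → A → Bool} → (∀ x y → Q x y ≡ Q′ x y) →
  IsComplete Q → IsComplete Q′
IsComplete-resp Q≗ comp x y = proj₁ (comp x y) ∘ trans (Q≗ x y) , trans (sym (Q≗ x y)) ∘ proj₂ (comp x y)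

IsStarAt-resp : ∀ {A : Set} {Q Q′ : A → A → Bool} {c} → (∀ x y → Q x y ≡ Q′ x y) →
  IsStarAt Q c → IsStarAt Q′ c
IsStarAt-resp Q≗ st x y = proj₁ (st x y) ∘ trans (Q≗ x y) , trans (sym (Q≗ x y)) ∘ proj₂ (st x y)

other : ∀ {k} → 2 ≤ k → (i : Fin k) → ∃ λ l → l ≢ i
other (s≤s (s≤s _)) zero    = suc zero , λ ()
other (s≤s (s≤s _)) (suc i) = zero , λ ()

module _ {k : ℕ} {n : Fin k → ℕ} (2≤k : 2 ≤ k) (z : ∀ i → Fin (n i)) where

  module _ {D : SplitDec k n} (valid : ValidDec D) where

    port : ∀ i → ∃ λ a → Q D i (just a) nothing ≡ true
    port i with valid-neighbour _≟ᴺ_ (proj₂ valid i) {nothing} {just (z i)} (λ ())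
    ... | nothing , e = contradiction refl (valid-≢ (proj₂ valid i) e)
    ... | just a  , e = a , valid-symᵗ (proj₂ valid i) e

    root-neighbour : ∀ i → ∃ λ l → Q₀ D i l ≡ true
    root-neighbour i = valid-neighbour _≟_ (proj₁ valid) (proj₂ (other 2≤k i))

    adjacent : ∀ {G} → Decomposes D G → ∀ {i l a b} → Q D i (just a) nothing ≡ true →
      Q₀ D i l ≡ true → Q D l (just b) nothing ≡ true → G (i , a) (l , b) ≡ true
    adjacent (_ , outer) {i} {l} {a} {b} p e p′ =
      trans (outer i l a b (valid-≢ (proj₁ valid) e))
        (cong₂ _∧_ p (cong₂ _∧_ e (valid-symᵗ (proj₂ valid l) p′)))

  module _ {D D′ : SplitDec k n} {G : Graph k n} (valid : ValidDec D)
           (dec : Decomposes D G) (dec′ : Decomposes D′ G) where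

    -- The link of `a` to sᵢ extends, through an edge of Q₀ and a linked leaf in the next part, to
    -- an edge of `G`. In `D′` that edge is a conjunction whose first factor is the wanted link;
    -- `root-⊆` extracts the middle factor in the same way.
    port-⊆ : ∀ i a → Q D i (just a) nothing ≡ true → Q D′ i (just a) nothing ≡ true
    port-⊆ i a p with root-neighbour valid i
    ... | l , e with port valid l
    ... | b , p′ = ∧-conicalˡ _ _ (trans (sym (proj₂ dec′ i l a b (valid-≢ (proj₁ valid) e)))
                     (adjacent valid dec p e p′))

    root-⊆ : ∀ i l → Q₀ D i l ≡ true → Q₀ D′ i l ≡ true
    root-⊆ i l e with port valid i | port valid l
    ... | a , p | b , p′ = ∧-conicalˡ _ _ (∧-conicalʳ (Q D′ i (just a) nothing) _
      (trans (sym (proj₂ dec′ i l a b (valid-≢ (proj₁ valid) e))) (adjacent valid dec p e p′)))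

  module _ {D D′ : SplitDec k n} {G : Graph k n} (valid : ValidDec D) (valid′ : ValidDec D′)
           (dec : Decomposes D G) (dec′ : Decomposes D′ G) where

    root-unique : ∀ i l → Q₀ D i l ≡ Q₀ D′ i l
    root-unique i l = ≡true-ext (root-⊆ {D} {D′} valid dec dec′ i l) (root-⊆ {D′} {D} valid′ dec′ dec i l)

    leaf-unique : ∀ i x y → Q D i x y ≡ Q D′ i x y
    leaf-unique i (just a) (just b) = trans (sym (proj₁ dec i a b)) (proj₁ dec′ i a b)
    leaf-unique i (just a) nothing  =
      ≡true-ext (port-⊆ {D} {D′} valid dec dec′ i a) (port-⊆ {D′} {D} valid′ dec′ dec i a)
    leaf-unique i nothing (just a) = ≡true-ext
      (valid-symᵗ (proj₂ valid′ i) ∘ port-⊆ {D} {D′} valid dec dec′ i a ∘ valid-symᵗ (proj₂ valid i))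
      (valid-symᵗ (proj₂ valid i) ∘ port-⊆ {D′} {D} valid′ dec′ dec i a ∘ valid-symᵗ (proj₂ valid′ i))
    leaf-unique i nothing nothing = ≡true-ext
      (λ e → contradiction refl (valid-≢ (proj₂ valid i) e))
      (λ e → contradiction refl (valid-≢ (proj₂ valid′ i) e))

module _ {k : ℕ} {n : Fin k → ℕ} where

  realize-valid : ∀ r (t : Centres {n = n}) → ValidDec (realize r t)
  realize-valid r t = ⟦⟧-valid _≟_ (rootShape r) , λ i → ⟦⟧-valid _≟ᴺ_ (leaves r t i)

  quotient-spoke : ∀ ρ {m} (x : Maybe (Fin m)) → ρ ≢ centre → is-just x ≡ true →
    StarSpoke ⟦ quotient ρ x ⟧
  quotient-spoke free   (just a) _ _ = a , ⟦star⟧-IsStarAt _≟ᴺ_ (just a)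
  quotient-spoke spoke  (just a) _ _ = a , ⟦star⟧-IsStarAt _≟ᴺ_ (just a)
  quotient-spoke centre (just a) ρ≢centre _ = contradiction refl ρ≢centre

  quotient-complete : ∀ {m} (x : Maybe (Fin m)) → is-just x ≡ true →
    IsComplete ⟦ quotient centre x ⟧
  quotient-complete (just _) _ = ⟦complete⟧-IsComplete _≟ᴺ_

  quotient-centre : ∀ {m} (x : Maybe (Fin m)) → is-just x ≡ false →
    StarCenter ⟦ quotient centre x ⟧
  quotient-centre nothing _ = ⟦star⟧-IsStarAt _≟ᴺ_ nothing

  realize-shape1 : ∀ {t : Centres {n = n}} → (∀ i → is-just (t i) ≡ true) →
    Shape1 (realize nothing t)
  realize-shape1 {t} all = ⟦complete⟧-IsComplete _≟_ , λ i → quotient-spoke free (t i) (λ ()) (all i)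

  realize-spokes : ∀ {j} {t : Centres {n = n}} → AllSpokes j t →
    ∀ i → i ≢ j → StarSpoke ⟦ leaves (just j) t i ⟧
  realize-spokes {j} {t} spokes i i≢j rewrite role-spoke i≢j = quotient-spoke spoke (t i) (λ ()) (spokes i i≢j)

  realize-shape2 : ∀ {j} {t : Centres {n = n}} → AllSpokes j t → is-just (t j) ≡ true →
    Shape2 j (realize (just j) t)
  realize-shape2 {j} {t} spokes tⱼ =
    ⟦star⟧-IsStarAt _≟_ j , centre-complete , realize-spokes {t = t} spokes
    where
    centre-complete : IsComplete ⟦ leaves (just j) t j ⟧
    centre-complete rewrite role-centre j = quotient-complete (t j) tⱼ

  realize-shape3 : ∀ {j} {t : Centres {n = n}} → AllSpokes j t → is-just (t j) ≡ false →
    Shape3 j (realize (just j) t)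
  realize-shape3 {j} {t} spokes tⱼ =
    ⟦star⟧-IsStarAt _≟_ j , centre-star , realize-spokes {t = t} spokes
    where
    centre-star : StarCenter ⟦ leaves (just j) t j ⟧
    centre-star rewrite role-centre j = quotient-centre (t j) tⱼ

  module _ {D D′ : SplitDec k n} (root : ∀ i l → Q₀ D i l ≡ Q₀ D′ i l)
           (leaf : ∀ i x y → Q D i x y ≡ Q D′ i x y) where

    StarSpoke-resp : ∀ i → StarSpoke (Q D i) → StarSpoke (Q D′ i)
    StarSpoke-resp i (a , st) = a , IsStarAt-resp (leaf i) st

    Shape1-resp : Shape1 D → Shape1 D′
    Shape1-resp (comp , spokes) =
      IsComplete-resp root comp , λ i → StarSpoke-resp i (spokes i)

    Shape2-resp : ∀ {j} → Shape2 j D → Shape2 j D′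
    Shape2-resp (st , comp , spokes) = IsStarAt-resp root st , IsComplete-resp (leaf _) comp ,
      λ i i≢j → StarSpoke-resp i (spokes i i≢j)

    Shape3-resp : ∀ {j} → Shape3 j D → Shape3 j D′
    Shape3-resp (st , ctr , spokes) = IsStarAt-resp root st , IsStarAt-resp (leaf _) ctr ,
      λ i i≢j → StarSpoke-resp i (spokes i i≢j)

-- Counting edges

sum-const : ∀ k c → sum {k} (const c) ≡ k * c
sum-const zero    c = refl
sum-const (suc k) c = cong (c +_) (sum-const k c)

sum-mono : ∀ {k} {f g : Fin k → ℕ} → (∀ i → f i ≤ g i) → sum f ≤ sum g
sum-mono {zero}  f≤g = z≤n
sum-mono {suc k} f≤g = +-mono-≤ (f≤g zero) (sum-mono (f≤g ∘ suc))

sum-mono-gap : ∀ {k} {f g : Fin k → ℕ} c {δ} → (∀ i → f i ≤ g i) → f c + δ ≤ g c →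
  sum f + δ ≤ sum g
sum-mono-gap {suc k} {f} zero {δ} f≤g gap = begin
  f zero + sum (f ∘ suc) + δ   ≡⟨ +-assoc (f zero) _ δ ⟩
  f zero + (sum (f ∘ suc) + δ) ≡⟨ cong (f zero +_) (+-comm _ δ) ⟩
  f zero + (δ + sum (f ∘ suc)) ≡⟨ +-assoc (f zero) δ _ ⟨
  f zero + δ + sum (f ∘ suc)   ≤⟨ +-mono-≤ gap (sum-mono (f≤g ∘ suc)) ⟩
  _                            ∎
  where open ≤-Reasoning
sum-mono-gap {suc k} {f} (suc c) {δ} f≤g gap = begin
  f zero + sum (f ∘ suc) + δ   ≡⟨ +-assoc (f zero) _ δ ⟩
  f zero + (sum (f ∘ suc) + δ) ≤⟨ +-mono-≤ (f≤g zero) (sum-mono-gap c (f≤g ∘ suc) gap) ⟩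
  _                            ∎
  where open ≤-Reasoning

drop-at : ∀ {k} → Fin k → (Fin k → ℕ) → Fin k → ℕ
drop-at j f i = if does (i ≟ j) then 0 else f i

keep-at : ∀ {k} → Fin k → (Fin k → ℕ) → Fin k → ℕ
keep-at j f i = if does (i ≟ j) then f i else 0

others : ∀ {k} → Fin k → (Fin k → ℕ) → ℕ
others j f = sum (drop-at j f)

sum-select : ∀ {k} (j : Fin k) (f : Fin k → ℕ) → sum (keep-at j f) ≡ f j
sum-select {suc k} zero    f = trans (cong (f zero +_) (sum-replicate-zero k)) (+-identityʳ _)
sum-select {suc k} (suc j) f = sum-select j (f ∘ suc)

others-split : ∀ {k} (j : Fin k) f → others j f + f j ≡ sum f
others-split j f = begin
  others j f + f j                              ≡⟨ cong (others j f +_) (sum-select j f) ⟨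
  others j f + sum (keep-at j f) ≡⟨ ∑-distrib-+ (drop-at j f) (keep-at j f) ⟨
  sum (λ i → drop-at j f i + keep-at j f i)
    ≡⟨ sum-cong-≗ (λ i → recombine (does (i ≟ j)) (f i)) ⟩
  sum f ∎
  where
  open ≡-Reasoning
  recombine : ∀ b x → (if b then 0 else x) + (if b then x else 0) ≡ x
  recombine true  x = refl
  recombine false x = +-identityʳ x

others-cong : ∀ {k} (j : Fin k) {f g} → (∀ i → i ≢ j → f i ≡ g i) → others j f ≡ others j g
others-cong j {f} {g} f≗g = sum-cong-≗ pointwise
  where
  pointwise : ∀ i → drop-at j f i ≡ drop-at j g i
  pointwise i with i ≟ j
  ... | yes _  = refl
  ... | no i≢j = f≗g i i≢j

others-const : ∀ {k} (j : Fin k) c → others j (const c) ≡ (k ∸ 1) * c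
others-const {suc k} j c = +-cancelʳ-≡ c _ _
  (trans (others-split j (const c)) (trans (sum-const (suc k) c) (+-comm c (k * c))))

others-+ : ∀ {k} (j : Fin k) f g → others j (λ i → f i + g i) ≡ others j f + others j g
others-+ j f g = trans (sum-cong-≗ λ i → push (does (i ≟ j)) (f i) (g i)) (∑-distrib-+ (drop-at j f) (drop-at j g))
  where
  push : ∀ b x y → (if b then 0 else x + y) ≡ (if b then 0 else x) + (if b then 0 else y)
  push true  x y = refl
  push false x y = refl

others-* : ∀ {k} (j : Fin k) c f → others j (λ i → c * f i) ≡ c * others j f
others-* j c f = trans (sum-cong-≗ λ i → push (does (i ≟ j)) (f i)) (sym (*-distribˡ-sum c (drop-at j f)))
  where
  push : ∀ b x → (if b then 0 else c * x) ≡ c * (if b then 0 else x)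
  push true  x = sym (*-zeroʳ c)
  push false x = refl

others-mono-gap : ∀ {k} {j : Fin k} {f g} c {δ} → c ≢ j → (∀ i → i ≢ j → f i ≤ g i) →
  f c + δ ≤ g c → others j f + δ ≤ others j g
others-mono-gap {j = j} {f} {g} c {δ} c≢j f≤g gap = sum-mono-gap c pointwise at
  where
  pointwise : ∀ i → drop-at j f i ≤ drop-at j g i
  pointwise i with i ≟ j
  ... | yes _  = z≤n
  ... | no i≢j = f≤g i i≢j
  at : drop-at j f c + δ ≤ drop-at j g c
  at rewrite dec-false (c ≟ j) c≢j = gap

complete-sum : ∀ {k} (w : Fin k → Fin k → ℕ) →
  sum (λ i → sum λ l → b2n (⟦ complete ⟧₀ i l) * w i l) ≡ sum (λ i → others i (w i))
complete-sum w = sum-cong-≗ λ i → sum-cong-≗ λ l →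
  trans (cong (λ b → b2n (not b) * w i l) (Root.≟-sym i l)) (weigh (does (l ≟ i)) (w i l))
  where
  weigh : ∀ b x → b2n (not b) * x ≡ (if b then 0 else x)
  weigh true  x = refl
  weigh false x = *-identityˡ x

star-sum : ∀ {k} (j : Fin k) (w : Fin k → Fin k → ℕ) → (∀ i l → w i l ≡ w l i) →
  sum (λ i → sum λ l → b2n (⟦ star j ⟧₀ i l) * w i l) ≡ 2 * others j (w j)
star-sum {k} j w w-sym = begin
  sum (λ i → sum λ l → b2n (⟦ star j ⟧₀ i l) * w i l)
    ≡⟨ (sum-cong-≗ λ i → trans (sum-cong-≗ (pointwise i)) (∑-distrib-+ (half i) λ l → half l i)) ⟩
  sum (λ i → sum (half i) + sum λ l → half l i)
    ≡⟨ ∑-distrib-+ (λ i → sum (half i)) (λ i → sum λ l → half l i) ⟩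
  sum (λ i → sum (half i)) + sum (λ i → sum λ l → half l i)
    ≡⟨ cong (sum (λ i → sum (half i)) +_) (∑-comm λ i l → half l i) ⟩
  sum (λ i → sum (half i)) + sum (λ i → sum (half i))
    ≡⟨ cong₂ _+_ half-sum half-sum ⟩
  others j (w j) + others j (w j)
    ≡⟨ cong (others j (w j) +_) (+-identityʳ _) ⟨
  2 * others j (w j) ∎
  where
  open ≡-Reasoning
  -- Only the ordered pairs from `j` to another index. The pairs in the opposite direction form its
  -- transpose, so both have the same total.
  half : ∀ i l → ℕ
  half i l = if does (i ≟ j) then (if does (l ≟ j) then 0 else w i l) else 0

  pointwise : ∀ i l → b2n (⟦ star j ⟧₀ i l) * w i l ≡ half i l + half l i
  pointwise i l with i ≟ j | l ≟ j
  ... | yes refl | yes refl rewrite ≟-refl i = refl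
  ... | yes refl | no l≢j rewrite dec-false (i ≟ l) (≢-sym l≢j) = refl
  ... | no i≢j | yes refl rewrite dec-false (i ≟ l) i≢j =
    trans (+-identityʳ _) (w-sym i l)
  ... | no _ | no _ rewrite ∧-zeroʳ (not (does (i ≟ l))) = refl

  half-sum : sum (λ i → sum (half i)) ≡ others j (w j)
  half-sum = trans (sum-cong-≗ λ i → pull (does (i ≟ j)) i) (sum-select j λ i → others j (w i))
    where
    pull : ∀ b i → sum (λ l → if b then (if does (l ≟ j) then 0 else w i l) else 0) ≡
      (if b then others j (w i) else 0)
    pull true  i = refl
    pull false i = sum-replicate-zero k

-- The degree of the split-node, that is, the number of leaves through which the part is joined to
-- the others.
degree : ∀ {m} → Shape (Node m) → ℕ
degree s = sum λ a → b2n (⟦ s ⟧ (just a) nothing)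

-- Counts ordered pairs, hence twice the edges inside the part.
internal : ∀ {m} → Shape (Node m) → ℕ
internal s = sum λ a → sum λ b → b2n (⟦ s ⟧ (just a) (just b))

degree-complete : ∀ m → degree {m} complete ≡ m
degree-complete m = trans (sum-const m 1) (*-identityʳ m)

degree-centre : ∀ m → degree {m} (star nothing) ≡ m
degree-centre m = trans (sum-const m 1) (*-identityʳ m)

degree-spoke : ∀ {m} (c : Fin m) → degree (star (just c)) ≡ 1
degree-spoke c = trans (sum-cong-≗ λ a → b2n-if (does (a ≟ c))) (sum-select c (const 1))
  where
  b2n-if : ∀ b → b2n (b ∨ false) ≡ (if b then 1 else 0)
  b2n-if true  = refl
  b2n-if false = refl

internal-complete : ∀ m → internal {m} complete ≡ m * (m ∸ 1)
internal-complete m = begin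
  internal {m} complete
    ≡⟨ (sum-cong-≗ {m} λ a → sum-cong-≗ {m} λ b → sym (*-identityʳ (b2n (not (does (a ≟ b)))))) ⟩
  sum {m} (λ a → sum {m} λ b → b2n (⟦ complete ⟧₀ a b) * 1)
    ≡⟨ complete-sum {m} (λ _ _ → 1) ⟩
  sum {m} (λ a → others a (const 1))
    ≡⟨ (sum-cong-≗ {m} λ a → trans (others-const {m} a 1) (*-identityʳ (m ∸ 1))) ⟩
  sum {m} (const (m ∸ 1))
    ≡⟨ sum-const m (m ∸ 1) ⟩
  m * (m ∸ 1) ∎
  where open ≡-Reasoning

internal-centre : ∀ m → internal {m} (star nothing) ≡ 0
internal-centre m = trans
  (sum-cong-≗ {m} λ a → trans
    (sum-cong-≗ {m} λ b → cong b2n (∧-zeroʳ (not (does (a ≟ b))))) (sum-replicate-zero m))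
  (sum-replicate-zero m)

internal-spoke : ∀ {m} (c : Fin m) → internal (star (just c)) ≡ 2 * (m ∸ 1)
internal-spoke {m} c = trans
  (sum-cong-≗ {m} λ a → sum-cong-≗ {m} λ b → sym (*-identityʳ (b2n (⟦ star c ⟧₀ a b))))
  (trans (star-sum c (λ _ _ → 1) (λ _ _ → refl))
    (cong (2 *_) (trans (others-const {m} c 1) (*-identityʳ (m ∸ 1)))))

sumᴸ-allFin : ∀ {k} (f : Fin k → ℕ) → sumFin f ≡ sum f
sumᴸ-allFin f = trans (cong sumᴸ (map-tabulate (λ i → i) f)) (go f)
  where
  go : ∀ {k} (g : Fin k → ℕ) → sumᴸ (tabulate g) ≡ sum g
  go {zero}  g = refl
  go {suc k} g = cong (g zero +_) (go (g ∘ suc))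

sumᴸ-concatMap : ∀ {A : Set} (f : A → List ℕ) xs →
  sumᴸ (concatMap f xs) ≡ sumᴸ (map (sumᴸ ∘ f) xs)
sumᴸ-concatMap f []       = refl
sumᴸ-concatMap f (x ∷ xs) =
  trans (sum-++ (f x) _) (cong (sumᴸ (f x) +_) (sumᴸ-concatMap f xs))

sumOthers-others : ∀ {k} (n : Fin k → ℕ) j → sumOthers n j ≡ others j (λ i → n i ∸ 1)
sumOthers-others n j = sumᴸ-allFin (drop-at j λ i → n i ∸ 1)

module _ {k : ℕ} {n : Fin k → ℕ} where

  sumᴸ-allVtx : (f : Vtx k n → ℕ) →
    sumᴸ (map f (allVtx k n)) ≡ sum (λ i → sum λ a → f (i , a))
  sumᴸ-allVtx f = begin
    sumᴸ (map f (allVtx k n))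
      ≡⟨ cong sumᴸ (map-concatMap f _ (allFin k)) ⟩
    sumᴸ (concatMap (λ i → map f (map (i ,_) (allFin (n i)))) (allFin k))
      ≡⟨ sumᴸ-concatMap _ (allFin k) ⟩
    sumFin (λ i → sumᴸ (map f (map (i ,_) (allFin (n i)))))
      ≡⟨ sumᴸ-allFin (λ i → sumᴸ (map f (map (i ,_) (allFin (n i))))) ⟩
    sum (λ i → sumᴸ (map f (map (i ,_) (allFin (n i)))))
      ≡⟨ (sum-cong-≗ λ i → trans (cong sumᴸ (sym (map-∘ (allFin (n i))))) (sumᴸ-allFin λ a → f (i , a))) ⟩
    sum (λ i → sum λ a → f (i , a)) ∎
    where open ≡-Reasoning

  -- Twice the number of edges. Counts and bounds are proved at this doubled level, and the division
  -- by 2 enters only in `numEdges-exact` and `numEdges-lower`.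
  degreeSum : Graph k n → ℕ
  degreeSum G = sum λ i → sum λ a → sum λ l → sum λ b → b2n (G (i , a) (l , b))

  numEdges-degreeSum : ∀ G → numEdges G ≡ degreeSum G / 2
  numEdges-degreeSum G = cong (_/ 2) (trans (sumᴸ-concatMap _ (allVtx k n))
    (trans (sumᴸ-allVtx _) (sum-cong-≗ λ i → sum-cong-≗ λ a → sumᴸ-allVtx λ w → b2n (G (i , a) w))))

  numEdges-exact : ∀ G {e} → degreeSum G ≡ 2 * e → numEdges G ≡ e
  numEdges-exact G {e} eq = trans (numEdges-degreeSum G)
    (trans (cong (_/ 2) (trans eq (*-comm 2 e))) (m*n/n≡m e 2))

  numEdges-lower : ∀ G {e} → 2 * e ≤ degreeSum G → e ≤ numEdges G
  numEdges-lower G {e} le rewrite numEdges-degreeSum G =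
    subst (_≤ degreeSum G / 2) (trans (cong (_/ 2) (*-comm 2 e)) (m*n/n≡m e 2)) (/-monoˡ-≤ 2 le)

  module _ {r : Shape (Fin k)} {q : LeafShapes {n = n}} {G : Graph k n}
           (dec : Decomposes (toDec r q) G) where

    -- Between two different parts `G` is either empty or complete bipartite on the leaves linked to
    -- the split-nodes, so the count is a product of degrees. For `l` equal to `i` the product term
    -- vanishes, as Q₀ has no loop.
    block : ∀ i l → sum (λ a → sum λ b → b2n (G (i , a) (l , b))) ≡
      (if does (l ≟ i) then internal (q l) else 0) +
      b2n (⟦ r ⟧₀ i l) * (degree (q i) * degree (q l))
    block i l with l ≟ i
    ... | yes refl rewrite Root.⟦⟧-irrefl r i = trans
      (sum-cong-≗ λ a → sum-cong-≗ λ b → cong b2n (proj₁ dec i a b)) (sym (+-identityʳ _))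
    ... | no l≢i = begin
      sum (λ a → sum λ b → b2n (G (i , a) (l , b)))
        ≡⟨ (sum-cong-≗ λ a → sum-cong-≗ λ b → entry a b) ⟩
      sum (λ a → sum λ b → e * x a * y b)
        ≡⟨ (sum-cong-≗ λ a → sym (*-distribˡ-sum (e * x a) y)) ⟩
      sum (λ a → e * x a * sum y)
        ≡⟨ sym (*-distribʳ-sum (sum y) (λ a → e * x a)) ⟩
      sum (λ a → e * x a) * sum y
        ≡⟨ cong (_* sum y) (sym (*-distribˡ-sum e x)) ⟩
      e * sum x * sum y
        ≡⟨ *-assoc e (sum x) (sum y) ⟩
      e * (sum x * sum y) ∎
      where
      open ≡-Reasoning
      e = b2n (⟦ r ⟧₀ i l)
      x : Fin (n i) → ℕ
      x a = b2n (⟦ q i ⟧ (just a) nothing)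
      y : Fin (n l) → ℕ
      y b = b2n (⟦ q l ⟧ (just b) nothing)
      b2n-∧ : ∀ u v w → b2n (u ∧ v ∧ w) ≡ b2n v * b2n u * b2n w
      b2n-∧ false true  w = refl
      b2n-∧ false false w = refl
      b2n-∧ true  false w = refl
      b2n-∧ true  true  w = sym (+-identityʳ _)
      entry : ∀ a b → b2n (G (i , a) (l , b)) ≡ e * x a * y b
      entry a b = trans (cong b2n (proj₂ dec i l a b (≢-sym l≢i)))
        (trans (cong (λ z → b2n (⟦ q i ⟧ (just a) nothing ∧ ⟦ r ⟧₀ i l ∧ z))
          (Leaf.⟦⟧-sym (q l) nothing (just b)))
          (b2n-∧ (⟦ q i ⟧ (just a) nothing) (⟦ r ⟧₀ i l) _))

    degreeSum-decomposes : degreeSum G ≡ sum (λ i → internal (q i)) +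
      sum (λ i → sum λ l → b2n (⟦ r ⟧₀ i l) * (degree (q i) * degree (q l)))
    degreeSum-decomposes = begin
      degreeSum G
        ≡⟨ (sum-cong-≗ λ i → ∑-comm λ a l → sum λ b → b2n (G (i , a) (l , b))) ⟩
      sum (λ i → sum λ l → sum λ a → sum λ b → b2n (G (i , a) (l , b)))
        ≡⟨ (sum-cong-≗ λ i → trans (sum-cong-≗ (block i)) (∑-distrib-+ (within i) (across i))) ⟩
      sum (λ i → sum (within i) + sum (across i))
        ≡⟨ ∑-distrib-+ (λ i → sum (within i)) (λ i → sum (across i)) ⟩
      sum (λ i → sum (within i)) + sum (λ i → sum (across i))
        ≡⟨ cong (_+ sum (λ i → sum (across i)))
             (sum-cong-≗ λ i → sum-select i λ l → internal (q l)) ⟩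
      sum (λ i → internal (q i)) + sum (λ i → sum (across i)) ∎
      where
      open ≡-Reasoning
      within across : Fin k → Fin k → ℕ
      within i = keep-at i λ l → internal (q l)
      across i l = b2n (⟦ r ⟧₀ i l) * (degree (q i) * degree (q l))

-- Bounds on the number of edges

-- The difference of the two sides is (x - 1)(y - 1).
x+y≤xy+1 : ∀ {x y} → 1 ≤ x → 1 ≤ y → x + y ≤ x * y + 1
x+y≤xy+1 {suc a} {suc b} _ _ = subst (suc a + suc b ≤_) (lemma a b) (m≤m+n _ (a * b))
  where
  lemma : ∀ a b → suc a + suc b + a * b ≡ suc a * suc b + 1
  lemma = solve-∀

2∣m[m∸1] : ∀ m → 2 ∣ m * (m ∸ 1)
2∣m[m∸1] zero = divides 0 refl
2∣m[m∸1] (suc zero) = divides 0 refl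
2∣m[m∸1] (suc (suc m)) =
  subst (2 ∣_) (lemma m) (∣m∣n⇒∣m+n (2∣m[m∸1] (suc m)) (m∣m*n {2} (suc m)))
  where
  lemma : ∀ m → suc m * m + 2 * suc m ≡ suc (suc m) * suc m
  lemma = solve-∀

double-half : ∀ m → 2 * ((m * (m ∸ 1)) / 2) ≡ m * (m ∸ 1)
double-half m = trans (*-comm 2 ((m * (m ∸ 1)) / 2)) (m/n*n≡m (2∣m[m∸1] m))

-- `x+y≤xy+1` summed over the ordered pairs of distinct indices: every `d i` occurs 2K times on the
-- left, and the constant 1 occurs (K + 1)K times on the right. Adding `sum d` to both sides
-- completes each `others i d` to a full sum and avoids subtraction.
complete-sum-lower : ∀ {K} (d : Fin (suc K) → ℕ) → (∀ i → 1 ≤ d i) →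
  2 * K * sum d ≤
    sum (λ i → sum λ l → b2n (⟦ complete ⟧₀ i l) * (d i * d l)) + suc K * K
complete-sum-lower {K} d 1≤d = +-cancelʳ-≤ (sum d) _ _ (begin
  2 * K * sum d + sum d
    ≡⟨ lemma K (sum d) ⟩
  K * sum d + suc K * sum d
    ≡⟨ cong₂ _+_ (*-distribˡ-sum K d) (sym (sum-const (suc K) (sum d))) ⟩
  sum (λ i → K * d i) + sum {suc K} (const (sum d))
    ≡⟨ sym (∑-distrib-+ (λ i → K * d i) (const (sum d))) ⟩
  sum (λ i → K * d i + sum d)
    ≡⟨ sum-cong-≗ regroup ⟩
  sum (λ i → others i (λ l → d i + d l) + d i)
    ≡⟨ ∑-distrib-+ (λ i → others i (λ l → d i + d l)) d ⟩
  sum (λ i → others i (λ l → d i + d l)) + sum d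
    ≤⟨ +-monoˡ-≤ (sum d) (sum-mono λ i → sum-mono (bound i)) ⟩
  sum (λ i → others i (λ l → d i * d l + 1)) + sum d
    ≡⟨ cong (_+ sum d) (trans (sum-cong-≗ λ i → trans (others-+ i (λ l → d i * d l) (const 1))
         (cong (others i (λ l → d i * d l) +_) (trans (others-const i 1) (*-identityʳ K))))
         (trans (∑-distrib-+ (λ i → others i (λ l → d i * d l)) (const K))
           (cong₂ _+_ (sym (complete-sum λ i l → d i * d l)) (sum-const (suc K) K)))) ⟩
  sum (λ i → sum λ l → b2n (⟦ complete ⟧₀ i l) * (d i * d l)) + suc K * K + sum d ∎)
  where
  open ≤-Reasoning
  lemma : ∀ K s → 2 * K * s + s ≡ K * s + suc K * s
  lemma = solve-∀
  regroup : ∀ i → K * d i + sum d ≡ others i (λ l → d i + d l) + d i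
  regroup i = trans (cong₂ _+_ (sym (others-const i (d i))) (sym (others-split i d)))
    (trans (sym (+-assoc (others i (const (d i))) (others i d) (d i)))
      (cong (_+ d i) (sym (others-+ i (const (d i)) d))))
  bound : ∀ i l → drop-at i (λ l → d i + d l) l ≤ drop-at i (λ l → d i * d l + 1) l
  bound i l with does (l ≟ i)
  ... | true  = z≤n
  ... | false = x+y≤xy+1 (1≤d i) (1≤d l)

is-nothing⇒ : ∀ {A : Set} {x : Maybe A} → is-just x ≡ false → x ≡ nothing
is-nothing⇒ {x = nothing} _ = refl

module Bounds {K : ℕ} {n : Fin (suc K) → ℕ} (2≤K : 2 ≤ K) (2≤n : ∀ i → 2 ≤ n i) where

  k : ℕ
  k = suc K

  excess : Fin k → ℕ
  excess i = n i ∸ 1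

  n≡ : ∀ i → n i ≡ suc (excess i)
  n≡ i = sym (m+[n∸m]≡n (≤-trans (s≤s z≤n) (2≤n i)))

  1≤excess : ∀ i → 1 ≤ excess i
  1≤excess i = ∸-monoˡ-≤ 1 (2≤n i)

  leavesTotal : ℕ
  leavesTotal = sum excess

  double-edges1 : 2 * edges1 k n ≡ 2 * leavesTotal + k * K
  double-edges1 = trans (*-distribˡ-+ 2 ((k * K) / 2) (sumFin excess))
    (trans (cong₂ _+_ (double-half k) (cong (2 *_) (sumᴸ-allFin excess))) (+-comm (k * K) _))

  -- `leavesTotal` does not depend on `j`, so this form exhibits the count as a function of `n j`
  -- that is strictly increasing for K ≥ 2.
  edges3-form : ∀ j → edges3 k n j ≡ leavesTotal + suc (n j * (K ∸ 1))
  edges3-form j = +-cancelʳ-≡ (excess j) _ _ (begin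
    n j * K + sumOthers n j + excess j
      ≡⟨ +-assoc (n j * K) _ _ ⟩
    n j * K + (sumOthers n j + excess j)
      ≡⟨ cong (n j * K +_) (trans (cong (_+ excess j) (sumOthers-others n j)) (others-split j excess)) ⟩
    n j * K + leavesTotal
      ≡⟨ cong₂ (λ m h → m * h + leavesTotal) (n≡ j) K≡ ⟩
    suc (excess j) * suc (K ∸ 1) + leavesTotal
      ≡⟨ lemma (excess j) (K ∸ 1) leavesTotal ⟩
    leavesTotal + suc (suc (excess j) * (K ∸ 1)) + excess j
      ≡⟨ cong (λ m → leavesTotal + suc (m * (K ∸ 1)) + excess j) (n≡ j) ⟨
    leavesTotal + suc (n j * (K ∸ 1)) + excess j ∎)
    where
    open ≡-Reasoning
    K≡ : K ≡ suc (K ∸ 1)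
    K≡ = sym (m+[n∸m]≡n (≤-trans (s≤s z≤n) 2≤K))
    lemma : ∀ y h N → suc y * suc h + N ≡ N + suc (suc y * h) + y
    lemma = solve-∀

  edges2-form : ∀ j → edges2 k n j ≡ edges3 k n j + (n j * excess j) / 2
  edges2-form j = lemma (n j * K) ((n j * excess j) / 2) (sumOthers n j)
    where
    lemma : ∀ a b c → a + b + c ≡ a + c + b
    lemma = solve-∀

  double-edges2 : ∀ j → 2 * edges2 k n j ≡ 2 * edges3 k n j + n j * excess j
  double-edges2 j = trans (cong (2 *_) (edges2-form j))
    (trans (*-distribˡ-+ 2 (edges3 k n j) ((n j * excess j) / 2))
      (cong (2 * edges3 k n j +_) (double-half (n j))))

  edges3-mono : ∀ {i j} → n i ≤ n j → edges3 k n i ≤ edges3 k n j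
  edges3-mono {i} {j} ni≤nj = subst₂ _≤_ (sym (edges3-form i)) (sym (edges3-form j))
    (+-monoʳ-≤ leavesTotal (s≤s (*-monoˡ-≤ (K ∸ 1) ni≤nj)))

  edges3-strict : ∀ {i j} → n i ℕ.< n j → edges3 k n i ℕ.< edges3 k n j
  edges3-strict {i} {j} ni<nj = subst₂ ℕ._<_ (sym (edges3-form i)) (sym (edges3-form j))
    (+-monoʳ-< leavesTotal (s≤s (*-monoˡ-< (K ∸ 1) {{>-nonZero (∸-monoˡ-≤ 1 2≤K)}} ni<nj)))

  halves-mono : ∀ {i j} → n i ≤ n j → (n i * excess i) / 2 ≤ (n j * excess j) / 2
  halves-mono ni≤nj = /-monoˡ-≤ 2 (*-mono-≤ ni≤nj (∸-monoˡ-≤ 1 ni≤nj))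

  edges2-mono : ∀ {i j} → n i ≤ n j → edges2 k n i ≤ edges2 k n j
  edges2-mono {i} {j} ni≤nj = subst₂ _≤_ (sym (edges2-form i)) (sym (edges2-form j))
    (+-mono-≤ (edges3-mono ni≤nj) (halves-mono ni≤nj))

  edges2-strict : ∀ {i j} → n i ℕ.< n j → edges2 k n i ℕ.< edges2 k n j
  edges2-strict {i} {j} ni<nj = subst₂ ℕ._<_ (sym (edges2-form i)) (sym (edges2-form j))
    (+-mono-<-≤ (edges3-strict ni<nj) (halves-mono (<⇒≤ ni<nj)))

  module _ {t : Centres {n = n}} {G : Graph k n} (dec : Decomposes (realize nothing t) G) where
    private
      q : LeafShapes {n = n}
      q = leaves nothing t

      S : ℕ
      S = sum λ i → sum λ l → b2n (⟦ complete ⟧₀ i l) * (degree (q i) * degree (q l))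

    complete-exact : (∀ i → is-just (t i) ≡ true) → numEdges G ≡ edges1 k n
    complete-exact all = numEdges-exact G (begin
      degreeSum G ≡⟨ degreeSum-decomposes {r = complete} {q} dec ⟩
      sum (λ i → internal (q i)) + S
        ≡⟨ cong₂ _+_ (trans (sum-cong-≗ λ i → int i) (sym (*-distribˡ-sum 2 excess))) S≡ ⟩
      2 * leavesTotal + k * K ≡⟨ double-edges1 ⟨
      2 * edges1 k n ∎)
      where
      open ≡-Reasoning
      int : ∀ i → internal (q i) ≡ 2 * excess i
      int i with t i | all i
      ... | just c | _ = internal-spoke c
      deg : ∀ i → degree (q i) ≡ 1
      deg i with t i | all i
      ... | just c | _ = degree-spoke c
      S≡ : S ≡ k * K
      S≡ = trans (sum-cong-≗ {k} λ i → sum-cong-≗ {k} λ l →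
             cong (b2n (⟦ complete ⟧₀ i l) *_) (cong₂ _*_ (deg i) (deg l)))
           (trans (complete-sum {k} (λ _ _ → 1))
           (trans (sum-cong-≗ {k} λ i → trans (others-const {k} i 1) (*-identityʳ K)) (sum-const k K)))

    -- After `complete-sum-lower` each part costs `internal + 2 * K * degree`. That is 2(n - 1) + 2K
    -- for a star-spoke and 2Kn for a star-center, a surplus of 2(K - 1)(n - 1), which is kept for
    -- `c` and dropped for the other parts.
    complete-lower : ∀ {c} → is-just (t c) ≡ false →
      2 * leavesTotal + k * K + 2 * ((K ∸ 1) * excess c) ≤ degreeSum G
    complete-lower {c} tc = +-cancelʳ-≤ (k * K) _ _ (begin
      2 * leavesTotal + k * K + 2 * ((K ∸ 1) * excess c) + k * K
        ≡⟨ lemma leavesTotal k K ((K ∸ 1) * excess c) ⟩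
      2 * leavesTotal + k * (2 * K) + 2 * ((K ∸ 1) * excess c)
        ≡⟨ cong (_+ 2 * ((K ∸ 1) * excess c)) (trans
             (cong₂ _+_ (*-distribˡ-sum 2 excess) (sym (sum-const k (2 * K))))
             (sym (∑-distrib-+ (λ i → 2 * excess i) (const (2 * K))))) ⟩
      sum (λ i → 2 * excess i + 2 * K) + 2 * ((K ∸ 1) * excess c)
        ≤⟨ sum-mono-gap c leaf-bound gap ⟩
      sum (λ i → internal (q i) + 2 * K * degree (q i))
        ≡⟨ trans (∑-distrib-+ (λ i → internal (q i)) (λ i → 2 * K * degree (q i)))
             (cong (sum (λ i → internal (q i)) +_) (sym (*-distribˡ-sum (2 * K) (λ i → degree (q i))))) ⟩
      sum (λ i → internal (q i)) + 2 * K * sum (λ i → degree (q i))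
        ≤⟨ +-monoʳ-≤ _ (complete-sum-lower (λ i → degree (q i)) 1≤degree) ⟩
      sum (λ i → internal (q i)) + (S + k * K)
        ≡⟨ +-assoc (sum (λ i → internal (q i))) S (k * K) ⟨
      sum (λ i → internal (q i)) + S + k * K
        ≡⟨ cong (_+ k * K) (degreeSum-decomposes {r = complete} {q} dec) ⟨
      degreeSum G + k * K ∎)
      where
      open ≤-Reasoning
      lemma : ∀ N k K x → 2 * N + k * K + 2 * x + k * K ≡ 2 * N + k * (2 * K) + 2 * x
      lemma = solve-∀
      1≤degree : ∀ i → 1 ≤ degree (q i)
      1≤degree i with t i
      ... | nothing = subst (1 ≤_) (sym (degree-centre (n i))) (≤-trans (s≤s z≤n) (2≤n i))
      ... | just c  = ≤-reflexive (sym (degree-spoke c))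
      expand : ∀ h y → 2 * y + 2 * suc h + 2 * (h * y) ≡ 2 * suc h * suc y
      expand = solve-∀
      K≡ : suc (K ∸ 1) ≡ K
      K≡ = m+[n∸m]≡n (≤-trans (s≤s z≤n) 2≤K)
      at-nothing : ∀ i → 2 * excess i + 2 * K + 2 * ((K ∸ 1) * excess i) ≡ 2 * K * n i
      at-nothing i rewrite n≡ i =
        subst (λ x → 2 * excess i + 2 * x + 2 * ((K ∸ 1) * excess i) ≡ 2 * x * suc (excess i))
          K≡ (expand (K ∸ 1) (excess i))
      leaf-bound : ∀ i → 2 * excess i + 2 * K ≤ internal (q i) + 2 * K * degree (q i)
      leaf-bound i with t i
      ... | just c rewrite internal-spoke c | degree-spoke c | *-identityʳ (2 * K) = ≤-refl
      ... | nothing rewrite internal-centre (n i) | degree-centre (n i) =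
        ≤-trans (m≤m+n _ _) (≤-reflexive (at-nothing i))
      gap : 2 * excess c + 2 * K + 2 * ((K ∸ 1) * excess c) ≤
        internal (q c) + 2 * K * degree (q c)
      gap rewrite is-nothing⇒ tc | internal-centre (n c) | degree-centre (n c) =
        ≤-reflexive (at-nothing c)

  module _ {j : Fin k} {t : Centres {n = n}} {G : Graph k n}
           (dec : Decomposes (realize (just j) t) G) where
    private
      q : LeafShapes {n = n}
      q = leaves (just j) t

      weight : Fin k → ℕ
      weight l = internal (q l) + 2 * n j * degree (q l)

    -- Both types of Qⱼ have split-node degree `n j`, so every other part meets Vⱼ in `n j * degree`
    -- edges and no two other parts are adjacent. The total splits exactly into one weight per part.
    star-total : degreeSum G ≡ internal (q j) + others j weight
    star-total = begin
      degreeSum G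
        ≡⟨ degreeSum-decomposes {r = star j} {q} dec ⟩
      sum (λ i → internal (q i)) + _
        ≡⟨ cong₂ _+_ (sym (others-split j λ i → internal (q i)))
             (star-sum j (λ i l → degree (q i) * degree (q l)) λ i l → *-comm (degree (q i)) _) ⟩
      others j (λ i → internal (q i)) + internal (q j) + 2 * others j (λ l → degree (q j) * degree (q l))
        ≡⟨ cong (others j (λ i → internal (q i)) + internal (q j) +_)
             (sym (others-* j 2 λ l → degree (q j) * degree (q l))) ⟩
      others j (λ i → internal (q i)) + internal (q j) + others j (λ l → 2 * (degree (q j) * degree (q l)))
        ≡⟨ cong₂ _+_ (+-comm (others j λ i → internal (q i)) (internal (q j)))
             (others-cong j λ l _ → trans (sym (*-assoc 2 (degree (q j)) (degree (q l))))
               (cong (λ d → 2 * d * degree (q l)) degⱼ)) ⟩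
      internal (q j) + others j (λ i → internal (q i)) + others j (λ l → 2 * n j * degree (q l))
        ≡⟨ +-assoc (internal (q j)) _ _ ⟩
      internal (q j) + (others j (λ i → internal (q i)) + others j (λ l → 2 * n j * degree (q l)))
        ≡⟨ cong (internal (q j) +_)
             (sym (others-+ j (λ i → internal (q i)) λ l → 2 * n j * degree (q l))) ⟩
      internal (q j) + others j weight ∎
      where
      open ≡-Reasoning
      degⱼ : degree (q j) ≡ n j
      degⱼ rewrite role-centre j with t j
      ... | nothing = degree-centre (n j)
      ... | just _  = degree-complete (n j)

    base-total : others j (λ l → 2 * excess l + 2 * n j) ≡ 2 * edges3 k n j
    base-total = begin
      others j (λ l → 2 * excess l + 2 * n j)
        ≡⟨ others-+ j (λ l → 2 * excess l) (const (2 * n j)) ⟩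
      others j (λ l → 2 * excess l) + others j (const (2 * n j))
        ≡⟨ cong₂ _+_ (trans (others-* j 2 excess) (cong (2 *_) (sym (sumOthers-others n j))))
             (others-const j (2 * n j)) ⟩
      2 * sumOthers n j + K * (2 * n j)
        ≡⟨ lemma (sumOthers n j) K (n j) ⟩
      2 * edges3 k n j ∎
      where
      open ≡-Reasoning
      lemma : ∀ s K m → 2 * s + K * (2 * m) ≡ 2 * (m * K + s)
      lemma = solve-∀

    weight-just : ∀ {l} → l ≢ j → is-just (t l) ≡ true → weight l ≡ 2 * excess l + 2 * n j
    weight-just {l} l≢j tₗ rewrite role-spoke l≢j with t l | tₗ
    ... | just c | _ rewrite internal-spoke c | degree-spoke c | *-identityʳ (2 * n j) = refl

    -- The bracket is the surplus of a complete Qₗ over a star-spoke one: more edges inside the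
    -- part, and `n l` instead of one linked leaf towards Vⱼ.
    weight-nothing : ∀ {l} → l ≢ j → is-just (t l) ≡ false →
      2 * excess l + 2 * n j + (excess l * (excess l ∸ 1) + 2 * n j * excess l) ≡ weight l
    weight-nothing {l} l≢j tₗ
      rewrite role-spoke l≢j | is-nothing⇒ tₗ | internal-complete (n l) | degree-complete (n l)
      = arith (n l) (2≤n l)
      where
      lemma : ∀ p m → 2 * suc p + 2 * m + (suc p * p + 2 * m * suc p) ≡
        suc (suc p) * suc p + 2 * m * suc (suc p)
      lemma = solve-∀
      arith : ∀ m → 2 ≤ m →
        2 * (m ∸ 1) + 2 * n j + ((m ∸ 1) * ((m ∸ 1) ∸ 1) + 2 * n j * (m ∸ 1)) ≡
        m * (m ∸ 1) + 2 * n j * m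
      arith (suc (suc p)) (s≤s (s≤s _)) = lemma p (n j)

    spokes-total : AllSpokes j t → degreeSum G ≡ internal (q j) + 2 * edges3 k n j
    spokes-total spokes = trans star-total (cong (internal (q j) +_)
      (trans (others-cong j λ l l≢j → weight-just l≢j (spokes l l≢j)) base-total))

    star-exact₂ : AllSpokes j t → is-just (t j) ≡ true → numEdges G ≡ edges2 k n j
    star-exact₂ spokes tⱼ = numEdges-exact G (trans (spokes-total spokes)
      (trans (cong (_+ 2 * edges3 k n j) int)
        (trans (+-comm (n j * excess j) _) (sym (double-edges2 j)))))
      where
      int : internal (q j) ≡ n j * excess j
      int rewrite role-centre j = centre-int (t j) tⱼ
        where
        centre-int : ∀ {m} (x : Maybe (Fin m)) → is-just x ≡ true →
          internal (quotient centre x) ≡ m * (m ∸ 1)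
        centre-int {m} (just _) _ = internal-complete m

    star-exact₃ : AllSpokes j t → is-just (t j) ≡ false → numEdges G ≡ edges3 k n j
    star-exact₃ spokes tⱼ = numEdges-exact G (trans (spokes-total spokes)
      (cong (_+ 2 * edges3 k n j) int))
      where
      int : internal (q j) ≡ 0
      int rewrite role-centre j | is-nothing⇒ tⱼ = internal-centre (n j)

    star-lower : ∀ {c} → c ≢ j → is-just (t c) ≡ false →
      2 * edges3 k n j + (excess c * (excess c ∸ 1) + 2 * n j * excess c) ≤ degreeSum G
    star-lower {c} c≢j tc = begin
      2 * edges3 k n j + δ
        ≡⟨ cong (_+ δ) base-total ⟨
      others j (λ l → 2 * excess l + 2 * n j) + δ
        ≤⟨ others-mono-gap c c≢j leaf-bound (≤-reflexive (weight-nothing c≢j tc)) ⟩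
      others j weight
        ≤⟨ m≤n+m _ (internal (q j)) ⟩
      internal (q j) + others j weight
        ≡⟨ star-total ⟨
      degreeSum G ∎
      where
      open ≤-Reasoning
      δ : ℕ
      δ = excess c * (excess c ∸ 1) + 2 * n j * excess c
      leaf-bound : ∀ l → l ≢ j → 2 * excess l + 2 * n j ≤ weight l
      leaf-bound l l≢j with is-just (t l) in tₗ
      ... | true  = ≤-reflexive (sym (weight-just l≢j tₗ))
      ... | false = ≤-trans (m≤m+n _ _) (≤-reflexive (weight-nothing l≢j tₗ))

  complete-lower₁ : ∀ {t G c} → Decomposes (realize nothing t) G → is-just (t c) ≡ false →
    edges1 k n ℕ.< numEdges G
  complete-lower₁ {t} {G} {c} dec tc = numEdges-lower G (begin
    2 * suc (edges1 k n)
      ≡⟨ trans (*-suc 2 (edges1 k n)) (+-comm 2 _) ⟩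
    2 * edges1 k n + 2
      ≡⟨ cong (_+ 2) double-edges1 ⟩
    2 * leavesTotal + k * K + 2 * (1 * 1)
      ≤⟨ +-monoʳ-≤ (2 * leavesTotal + k * K)
           (*-monoʳ-≤ 2 (*-mono-≤ (∸-monoˡ-≤ 1 2≤K) (1≤excess c))) ⟩
    2 * leavesTotal + k * K + 2 * ((K ∸ 1) * excess c)
      ≤⟨ complete-lower {t = t} dec tc ⟩
    degreeSum G ∎)
    where open ≤-Reasoning

  -- Serves odd k, where complete Q₀ with only star-spoke parts is unbalanced and the competitor has
  -- a star Q₀. Minimality of `n j` is applied at `c`, where it bounds the competitor by the surplus
  -- of the star-center part.
  complete-lower₃ : ∀ {t G c j} → IsMinIndex n j → Decomposes (realize nothing t) G →
    is-just (t c) ≡ false → edges3 k n j ℕ.< numEdges G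
  complete-lower₃ {t} {G} {c} {j} min dec tc = numEdges-lower G (begin
    2 * suc (edges3 k n j)
      ≡⟨ cong (λ e → 2 * suc e) (edges3-form j) ⟩
    2 * suc (leavesTotal + suc (n j * (K ∸ 1)))
      ≤⟨ arith (n j) (excess c) K 2≤K (≤-trans (min c) (≤-reflexive (n≡ c))) ⟩
    2 * leavesTotal + k * K + 2 * ((K ∸ 1) * excess c)
      ≤⟨ complete-lower {t = t} dec tc ⟩
    degreeSum G ∎)
    where
    open ≤-Reasoning
    -- Here K = h + 2 and y is the excess of `c`. The slack is (K - 2)(K + 1), which is zero for k =
    -- 3; strictness comes from the outer `suc`.
    lemma : ∀ N h y → 2 * suc (N + suc (suc y * suc h)) + (h * h + 3 * h) ≡
      2 * N + suc (suc (suc h)) * suc (suc h) + 2 * (suc h * y)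
    lemma = solve-∀
    arith : ∀ m y K → 2 ≤ K → m ≤ suc y → 2 * suc (leavesTotal + suc (m * (K ∸ 1))) ≤
      2 * leavesTotal + suc K * K + 2 * ((K ∸ 1) * y)
    arith m y (suc (suc h)) (s≤s (s≤s _)) m≤ = ≤-trans
      (*-monoʳ-≤ 2 (s≤s (+-monoʳ-≤ leavesTotal (s≤s (*-monoˡ-≤ (suc h) m≤)))))
      (≤-trans (m≤m+n _ (h * h + 3 * h)) (≤-reflexive (lemma leavesTotal h y)))

  star-lower₃ : ∀ {i j t G c} → IsMinIndex n i → Decomposes (realize (just j) t) G →
    c ≢ j → is-just (t c) ≡ false → edges3 k n i ℕ.< numEdges G
  star-lower₃ {i} {j} {t} {G} {c} min dec c≢j tc = numEdges-lower G (begin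
    2 * suc (edges3 k n i)
      ≡⟨ trans (*-suc 2 (edges3 k n i)) (+-comm 2 _) ⟩
    2 * edges3 k n i + 2 * 1 * 1
      ≤⟨ +-mono-≤ (*-monoʳ-≤ 2 (edges3-mono (min j)))
           (*-mono-≤ (*-monoʳ-≤ 2 (≤-trans (s≤s z≤n) (2≤n j))) (1≤excess c)) ⟩
    2 * edges3 k n j + 2 * n j * excess c
      ≤⟨ +-monoʳ-≤ (2 * edges3 k n j) (m≤n+m _ _) ⟩
    2 * edges3 k n j + (excess c * (excess c ∸ 1) + 2 * n j * excess c)
      ≤⟨ star-lower {t = t} dec c≢j tc ⟩
    degreeSum G ∎)
    where open ≤-Reasoning

  -- The competitor now also carries the edges of a complete Qᵢ, and the surplus of a complete Q at
  -- `c` must outweigh them. If all three sizes equal m, the doubled counts leave a slack of 2(m -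
  -- 1)² - 2, nonnegative for m ≥ 2; larger `n j` and `n c` only increase it.
  star-lower₂ : ∀ {i j t G c} → IsMinIndex n i → Decomposes (realize (just j) t) G →
    c ≢ j → is-just (t c) ≡ false → edges2 k n i ℕ.< numEdges G
  star-lower₂ {i} {j} {t} {G} {c} min dec c≢j tc = numEdges-lower G (begin
    2 * suc (edges2 k n i)
      ≡⟨ trans (*-suc 2 (edges2 k n i)) (+-comm 2 _) ⟩
    2 * edges2 k n i + 2
      ≡⟨ trans (cong (_+ 2) (double-edges2 i)) (+-assoc (2 * edges3 k n i) _ 2) ⟩
    2 * edges3 k n i + (n i * excess i + 2)
      ≤⟨ +-mono-≤ (*-monoʳ-≤ 2 (edges3-mono (min j)))
           (arith (n i) (n j) (n c) (2≤n i) (min j) (min c)) ⟩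
    2 * edges3 k n j + (excess c * (excess c ∸ 1) + 2 * n j * excess c)
      ≤⟨ star-lower {t = t} dec c≢j tc ⟩
    degreeSum G ∎)
    where
    open ≤-Reasoning
    -- The minimal size is p + 2, the size of the centre part exceeds it by v and that of `c` by u.
    -- The long bracket is the slack.
    lemma : ∀ p u v → suc (suc p) * suc p + 2 +
      (2 * p * p + 4 * p + u * (1 + 2 * p + u) + 2 * (2 + p) * u + 2 * v * (1 + p + u)) ≡
      suc (p + u) * (p + u) + 2 * suc (suc (p + v)) * suc (p + u)
    lemma = solve-∀
    arith : ∀ m mⱼ m′ → 2 ≤ m → m ≤ mⱼ → m ≤ m′ →
      m * (m ∸ 1) + 2 ≤ (m′ ∸ 1) * ((m′ ∸ 1) ∸ 1) + 2 * mⱼ * (m′ ∸ 1)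
    arith (suc (suc p)) mⱼ m′ (s≤s (s≤s _)) m≤mⱼ m≤m′ with m≤n⇒∃[o]m+o≡n m≤mⱼ | m≤n⇒∃[o]m+o≡n m≤m′
    ... | v , refl | u , refl =
      ≤-trans (m≤m+n _ _) (≤-reflexive (lemma p u v))

-- Signs of integer differences, and encodings of given shapes

open import Data.Integer using (+_; _<_)

diff-pos : ∀ {a c} → + 0 < + a ℤ.- + c → c ℕ.< a
diff-pos 0<a-c = ≰⇒> λ a≤c → ℤ.<⇒≱ 0<a-c (ℤ.i≤j⇒i-j≤0 (ℤ.+≤+ a≤c))

diff-neg : ∀ {a c} → + a ℤ.- + c < + 0 → a ℕ.< c
diff-neg a-c<0 = ≰⇒> λ c≤a → ℤ.<⇒≱ a-c<0 (ℤ.i≤j⇒0≤j-i (ℤ.+≤+ c≤a))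

diff-zero : ∀ {a c} → + a ℤ.- + c ≡ + 0 → a ≡ c
diff-zero {a} {c} eq = ℤ.+-injective (ℤ.i-j≡0⇒i≡j (+ a) (+ c) eq)

module _ {A : Set} (_≟ᴬ_ : DecidableEquality A) where
  open Quotient _≟ᴬ_ using () renaming (⟦_⟧ to ⟦_⟧ᴬ)

  IsComplete-unique : ∀ {Q} → IsComplete Q → ∀ x y → Q x y ≡ ⟦ complete ⟧ᴬ x y
  IsComplete-unique comp x y = ≡true-ext
    (proj₂ (⟦complete⟧-IsComplete _≟ᴬ_ x y) ∘ proj₁ (comp x y))
    (proj₂ (comp x y) ∘ proj₁ (⟦complete⟧-IsComplete _≟ᴬ_ x y))

  IsStarAt-unique : ∀ {Q c} → IsStarAt Q c → ∀ x y → Q x y ≡ ⟦ star c ⟧ᴬ x y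
  IsStarAt-unique {c = c} st x y = ≡true-ext
    (proj₂ (⟦star⟧-IsStarAt _≟ᴬ_ c x y) ∘ proj₁ (st x y))
    (proj₂ (st x y) ∘ proj₁ (⟦star⟧-IsStarAt _≟ᴬ_ c x y))

module _ {k : ℕ} {n : Fin k → ℕ} where

  Decomposes-congᴰ : ∀ {D D′ : SplitDec k n} {G} → (∀ i l → Q₀ D i l ≡ Q₀ D′ i l) →
    (∀ i x y → Q D i x y ≡ Q D′ i x y) → Decomposes D G → Decomposes D′ G
  Decomposes-congᴰ root leaf (inner , outer) =
    (λ i a b → trans (inner i a b) (leaf i (just a) (just b))) ,
    (λ i l a b i≢l → trans (outer i l a b i≢l)
      (cong₂ _∧_ (leaf i (just a) nothing) (cong₂ _∧_ (root i l) (leaf l nothing (just b)))))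

  -- The edge counts are stated for `realize`. For f = 0 the shape of an arbitrary `D` is a
  -- hypothesis, and this brings it into that form.
  shape1-realize : ∀ {D : SplitDec k n} {G} → Shape1 D → Decomposes D G →
    ∃ λ t → (∀ i → is-just (t i) ≡ true) × Decomposes (realize nothing t) G
  shape1-realize (comp , spokes) dec = (λ i → just (proj₁ (spokes i))) , (λ _ → refl) ,
    Decomposes-congᴰ (IsComplete-unique _≟_ comp)
      (λ i → IsStarAt-unique _≟ᴺ_ (proj₂ (spokes i))) dec

  shape2-realize : ∀ {D : SplitDec k n} {G j} → Fin (n j) → Shape2 j D → Decomposes D G →
    ∃ λ t → AllSpokes j t × is-just (t j) ≡ true × Decomposes (realize (just j) t) G
  shape2-realize {D} {G} {j} z (st , comp , spokes) dec =
    t , (λ l _ → all l) , all j , Decomposes-congᴰ (IsStarAt-unique _≟_ st) leaf dec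
    where
    t : Centres {n = n}
    t i with i ≟ j
    -- An arbitrary leaf: at the centre `just` only records that Qⱼ is complete.
    ... | yes refl = just z
    ... | no i≢j   = just (proj₁ (spokes i i≢j))
    all : ∀ i → is-just (t i) ≡ true
    all i with i ≟ j
    ... | yes refl = refl
    ... | no _     = refl
    leaf : ∀ i x y → Q D i x y ≡ ⟦ leaves (just j) t i ⟧ x y
    leaf i with i ≟ j
    ... | yes refl = IsComplete-unique _≟ᴺ_ comp
    ... | no i≢j   = IsStarAt-unique _≟ᴺ_ (proj₂ (spokes i i≢j))

  unspoked? : ∀ j (t : Centres {n = n}) → AllSpokes j t ⊎ ∃ λ c → c ≢ j × is-just (t c) ≡ false
  unspoked? j t with any? (λ l → ¬? (l ≟ j) ×-dec (is-just (t l) Bool.≟ false))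
  ... | yes found = inj₂ found
  ... | no none   = inj₁ λ l l≢j → ¬-not λ tₗ → none (l , l≢j , tₗ)

  unmarked? : (t : Centres {n = n}) →
    (∀ l → is-just (t l) ≡ true) ⊎ ∃ λ c → is-just (t c) ≡ false
  unmarked? t with any? (λ l → is-just (t l) Bool.≟ false)
  ... | yes found = inj₂ found
  ... | no none   = inj₁ λ l → ¬-not λ tₗ → none (l , tₗ)

-- The minimum over the orbit

module Optimum {K : ℕ} {n : Fin (suc K) → ℕ} (2≤K : 2 ≤ K) (2≤n : ∀ i → 2 ≤ n i)
               {j : Fin (suc K)} (min : IsMinIndex n j) where
  open Bounds {n = n} 2≤K 2≤n

  z : ∀ i → Fin (n i)
  z i = fromℕ< (≤-trans (s≤s z≤n) (2≤n i))

  -- The two added terms are the positive and the negative part of f, so this says that `edges2`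
  -- minus `edges1` equals f, without subtraction. Doubling first clears the halves.
  edges-balance : edges1 k n + ((n j ∸ 1) * K + ((n j ∸ 2) * (n j ∸ 1)) / 2) ≡
    edges2 k n j + ((K ∸ 1) * K) / 2
  edges-balance = *-cancelˡ-≡ _ _ 2 (begin
    2 * (edges1 k n + (a + ((n j ∸ 2) * (n j ∸ 1)) / 2))
      ≡⟨ distrib₃ (edges1 k n) a _ ⟩
    2 * edges1 k n + (2 * a + 2 * (((n j ∸ 2) * (n j ∸ 1)) / 2))
      ≡⟨ cong₂ (λ x y → x + (2 * a + y)) double-edges1 halfₙ ⟩
    2 * leavesTotal + suc K * K + (2 * a + (n j ∸ 2) * (n j ∸ 1))
      ≡⟨ arith K (n j) 2≤K (2≤n j) ⟩
    2 * (leavesTotal + suc (n j * (K ∸ 1))) + n j * (n j ∸ 1) + (K ∸ 1) * K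
      ≡⟨ cong₂ (λ x y → x + y) (trans (cong (λ e → 2 * e + n j * (n j ∸ 1)) (sym (edges3-form j)))
           (sym (double-edges2 j))) (sym halfₖ) ⟩
    2 * edges2 k n j + 2 * (((K ∸ 1) * K) / 2)
      ≡⟨ *-distribˡ-+ 2 (edges2 k n j) (((K ∸ 1) * K) / 2) ⟨
    2 * (edges2 k n j + ((K ∸ 1) * K) / 2) ∎)
    where
    open ≡-Reasoning
    a : ℕ
    a = (n j ∸ 1) * K
    distrib₃ : ∀ x y z → 2 * (x + (y + z)) ≡ 2 * x + (2 * y + 2 * z)
    distrib₃ = solve-∀
    half : ∀ m → 2 * (((m ∸ 1) * m) / 2) ≡ (m ∸ 1) * m
    half m = trans (cong (λ x → 2 * (x / 2)) (*-comm (m ∸ 1) m))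
      (trans (double-half m) (*-comm m (m ∸ 1)))
    halfₖ : 2 * (((K ∸ 1) * K) / 2) ≡ (K ∸ 1) * K
    halfₖ = half K
    halfₙ : 2 * (((n j ∸ 2) * (n j ∸ 1)) / 2) ≡ (n j ∸ 2) * (n j ∸ 1)
    halfₙ = subst (λ p → 2 * ((p * (n j ∸ 1)) / 2) ≡ p * (n j ∸ 1))
      (∸-+-assoc (n j) 1 1) (half (n j ∸ 1))
    lemma : ∀ N h p → 2 * N + suc (suc h) * suc h + (2 * (suc p * suc h) + p * suc p) ≡
      2 * (N + suc (suc (suc p) * h)) + suc (suc p) * suc p + h * suc h
    lemma = solve-∀
    arith : ∀ K m → 2 ≤ K → 2 ≤ m →
      2 * leavesTotal + suc K * K + (2 * ((m ∸ 1) * K) + (m ∸ 2) * (m ∸ 1)) ≡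
      2 * (leavesTotal + suc (m * (K ∸ 1))) + m * (m ∸ 1) + (K ∸ 1) * K
    arith (suc h) (suc (suc p)) _ (s≤s (s≤s _)) = lemma leavesTotal h p

  fkn-pos : + 0 < fkn k (n j) → edges1 k n ℕ.< edges2 k n j
  fkn-pos 0<f = +-cancelʳ-< (((K ∸ 1) * K) / 2) _ _
    (<-≤-trans (+-monoʳ-< (edges1 k n) (diff-pos 0<f)) (≤-reflexive edges-balance))

  fkn-neg : fkn k (n j) < + 0 → edges2 k n j ℕ.< edges1 k n
  fkn-neg f<0 = +-cancelʳ-< (((K ∸ 1) * K) / 2) _ _
    (≤-<-trans (≤-reflexive (sym edges-balance)) (+-monoʳ-< (edges1 k n) (diff-neg f<0)))

  fkn-zero : fkn k (n j) ≡ + 0 → edges1 k n ≡ edges2 k n j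
  fkn-zero f≡0 = +-cancelʳ-≡ (((K ∸ 1) * K) / 2) _ _
    (trans (cong (λ x → edges1 k n + x) (sym (diff-zero f≡0))) edges-balance)

  Orbit : Graph k n → Set
  Orbit = InOrbit (completeMultipartite k n)

  module _ {G : Graph k n} where

    -- A graph outside the two shapes strictly exceeds `edges1` or `edges2`, according to its Q₀.
    -- Both values are attained for even k (`attain₁`, `attain₂`), so either excess rules out
    -- minimality.
    even-cases : k % 2 ≡ 0 → ∀ r t → Balanced t → Decomposes (realize r t) G →
      (r ≡ nothing × (∀ i → is-just (t i) ≡ true)) ⊎
      (∃ λ j′ → r ≡ just j′ × AllSpokes j′ t × is-just (t j′) ≡ true) ⊎
      (edges1 k n ℕ.< numEdges G ⊎ edges2 k n j ℕ.< numEdges G)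
    even-cases even nothing t bal dec with unmarked? t
    ... | inj₁ all     = inj₁ (refl , all)
    ... | inj₂ (_ , e) = inj₂ (inj₂ (inj₁ (complete-lower₁ {t = t} dec e)))
    even-cases even (just j′) t bal dec with unspoked? j′ t
    ... | inj₁ spokes =
      inj₂ (inj₁ (j′ , refl , spokes , balanced-even even spokes bal))
    ... | inj₂ (_ , c≢j′ , e) = inj₂ (inj₂ (inj₂ (star-lower₂ {t = t} min dec c≢j′ e)))

    odd-cases : k % 2 ≡ 1 → ∀ r t → Balanced t → Decomposes (realize r t) G →
      (∃ λ j′ → r ≡ just j′ × AllSpokes j′ t × is-just (t j′) ≡ false) ⊎
      edges3 k n j ℕ.< numEdges G
    odd-cases odd nothing t bal dec with unmarked? t
    ... | inj₂ (_ , e) = inj₂ (complete-lower₃ {t = t} min dec e)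
    -- All k entries are `just` and k is odd, which contradicts balance; `balanced-odd` can be read
    -- at any index, here `j`.
    ... | inj₁ all     = contradiction (trans (sym (all j))
      (balanced-odd {j = j} odd (λ l _ → all l) bal)) λ ()
    odd-cases odd (just j′) t bal dec with unspoked? j′ t
    ... | inj₁ spokes =
      inj₁ (j′ , refl , spokes , balanced-odd odd spokes bal)
    ... | inj₂ (_ , c≢j′ , e) = inj₂ (star-lower₃ {t = t} min dec c≢j′ e)

  attain₁ : k % 2 ≡ 0 → ∃₂ λ G t → Orbit G × (∀ l → is-just (t l) ≡ true) ×
    Decomposes (realize nothing t) G
  attain₁ even with reached-complete z j even
  ... | t , (G , orbit , _ , dec) , all = G , t , orbit , all , dec

  attain₂ : k % 2 ≡ 0 → ∃₂ λ G t → Orbit G × AllSpokes j t × is-just (t j) ≡ true ×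
    Decomposes (realize (just j) t) G
  attain₂ even with reached-star z j
  ... | t , (G , orbit , bal , dec) , spokes =
    G , t , orbit , spokes , balanced-even even spokes bal , dec

  attain₃ : k % 2 ≡ 1 → ∃₂ λ G t → Orbit G × AllSpokes j t × is-just (t j) ≡ false ×
    Decomposes (realize (just j) t) G
  attain₃ odd with reached-star z j
  ... | t , (G , orbit , bal , dec) , spokes =
    G , t , orbit , spokes , balanced-odd odd spokes bal , dec

  module _ {G : Graph k n} (minimal : MinInOrbit (completeMultipartite k n) G) where

    minimal₁ : k % 2 ≡ 0 → numEdges G ≤ edges1 k n
    minimal₁ even with attain₁ even
    ... | H , t , orbit , all , dec =
      subst (numEdges G ≤_) (complete-exact {t = t} dec all) (proj₂ minimal H orbit)

    minimal₂ : k % 2 ≡ 0 → numEdges G ≤ edges2 k n j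
    minimal₂ even with attain₂ even
    ... | H , t , orbit , spokes , tⱼ , dec =
      subst (numEdges G ≤_) (star-exact₂ {t = t} dec spokes tⱼ) (proj₂ minimal H orbit)

    minimal₃ : k % 2 ≡ 1 → numEdges G ≤ edges3 k n j
    minimal₃ odd with attain₃ odd
    ... | H , t , orbit , spokes , tⱼ , dec =
      subst (numEdges G ≤_) (star-exact₃ {t = t} dec spokes tⱼ) (proj₂ minimal H orbit)

    module _ {D : SplitDec k n} (valid : ValidDec D) (dec : Decomposes D G) where
      private
        2≤k : 2 ≤ k
        2≤k = ≤-trans 2≤K (n≤1+n K)

        -- By uniqueness the encoding found by following the orbit has the same quotient graphs as
        -- `D`, so shapes proved for it carry over.
        module Same {r t} (dec′ : Decomposes (realize r t) G) where
          root : ∀ i l → Q₀ (realize r t) i l ≡ Q₀ D i l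
          root = root-unique 2≤k z (realize-valid r t) valid dec′ dec
          leaf : ∀ i x y → Q (realize r t) i x y ≡ Q D i x y
          leaf = leaf-unique 2≤k z (realize-valid r t) valid dec′ dec

      minimal-pos : k % 2 ≡ 0 → + 0 < fkn k (n j) → Shape1 D × numEdges G ≡ edges1 k n
      minimal-pos even 0<f with orbit-described z (proj₁ minimal)
      ... | r , t , bal , dec′ with even-cases even r t bal dec′
      ...   | inj₁ (refl , all) =
        Shape1-resp root leaf (realize-shape1 {t = t} all) , complete-exact {t = t} dec′ all
        where open Same {nothing} {t} dec′
      ...   | inj₂ (inj₁ (j′ , refl , spokes , tⱼ)) = contradiction (minimal₁ even)
        (<⇒≱ (<-≤-trans (fkn-pos 0<f) (≤-trans (edges2-mono (min j′))
          (≤-reflexive (sym (star-exact₂ {t = t} dec′ spokes tⱼ))))))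
      ...   | inj₂ (inj₂ (inj₁ e<)) = contradiction (minimal₁ even) (<⇒≱ e<)
      ...   | inj₂ (inj₂ (inj₂ e<)) = contradiction (minimal₁ even) (<⇒≱ (<-trans (fkn-pos 0<f) e<))

      -- With several smallest parts the star may point towards any of them, so the centre `j′` is
      -- read off from `G`. Its part is smallest because `edges2` is strictly increasing in the part
      -- size and the value at `j` is attained.
      minimal-neg : k % 2 ≡ 0 → fkn k (n j) < + 0 →
        Σ (Fin k) λ j′ → IsMinIndex n j′ × Shape2 j′ D × numEdges G ≡ edges2 k n j′
      minimal-neg even f<0 with orbit-described z (proj₁ minimal)
      ... | r , t , bal , dec′ with even-cases even r t bal dec′
      ...   | inj₁ (refl , all) = contradiction (minimal₂ even)
        (<⇒≱ (<-≤-trans (fkn-neg f<0) (≤-reflexive (sym (complete-exact {t = t} dec′ all)))))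
      ...   | inj₂ (inj₁ (j′ , refl , spokes , tⱼ)) =
        j′ , (λ i → ≤-trans nj′≤nj (min i)) ,
        Shape2-resp root leaf (realize-shape2 {t = t} spokes tⱼ) , exact
        where
        open Same {just j′} {t} dec′
        exact : numEdges G ≡ edges2 k n j′
        exact = star-exact₂ {t = t} dec′ spokes tⱼ
        nj′≤nj : n j′ ≤ n j
        nj′≤nj = ≮⇒≥ λ nj<nj′ → <⇒≱ (edges2-strict nj<nj′)
          (subst (_≤ edges2 k n j) exact (minimal₂ even))
      ...   | inj₂ (inj₂ (inj₁ e<)) = contradiction (minimal₂ even) (<⇒≱ (<-trans (fkn-neg f<0) e<))
      ...   | inj₂ (inj₂ (inj₂ e<)) = contradiction (minimal₂ even) (<⇒≱ e<)

      minimal-odd : k % 2 ≡ 1 →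
        Σ (Fin k) λ j′ → IsMinIndex n j′ × Shape3 j′ D × numEdges G ≡ edges3 k n j′
      minimal-odd odd with orbit-described z (proj₁ minimal)
      ... | r , t , bal , dec′ with odd-cases odd r t bal dec′
      ...   | inj₂ e< = contradiction (minimal₃ odd) (<⇒≱ e<)
      ...   | inj₁ (j′ , refl , spokes , tⱼ) =
        j′ , (λ i → ≤-trans nj′≤nj (min i)) ,
        Shape3-resp root leaf (realize-shape3 {t = t} spokes tⱼ) , exact
        where
        open Same {just j′} {t} dec′
        exact : numEdges G ≡ edges3 k n j′
        exact = star-exact₃ {t = t} dec′ spokes tⱼ
        nj′≤nj : n j′ ≤ n j
        nj′≤nj = ≮⇒≥ λ nj<nj′ → <⇒≱ (edges3-strict nj<nj′)
          (subst (_≤ edges3 k n j) exact (minimal₃ odd))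

  module _ (even : k % 2 ≡ 0) (f≡0 : fkn k (n j) ≡ + 0) where

    edges1-lower : ∀ H → Orbit H → edges1 k n ≤ numEdges H
    edges1-lower H orbit with orbit-described z orbit
    ... | r , t , bal , dec with even-cases even r t bal dec
    ...   | inj₁ (refl , all) = ≤-reflexive (sym (complete-exact {t = t} dec all))
    ...   | inj₂ (inj₁ (j′ , refl , spokes , tⱼ)) = ≤-trans (≤-reflexive (fkn-zero f≡0))
      (≤-trans (edges2-mono (min j′)) (≤-reflexive (sym (star-exact₂ {t = t} dec spokes tⱼ))))
    ...   | inj₂ (inj₂ (inj₁ e<)) = <⇒≤ e<
    ...   | inj₂ (inj₂ (inj₂ e<)) = ≤-trans (≤-reflexive (fkn-zero f≡0)) (<⇒≤ e<)

    shape1-minimal : ∀ H D → Orbit H → Decomposes D H → Shape1 D →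
      MinInOrbit (completeMultipartite k n) H
    shape1-minimal H D orbit dec shape = orbit , λ H′ orbit′ →
      ≤-trans (≤-reflexive exact) (edges1-lower H′ orbit′)
      where
      exact : numEdges H ≡ edges1 k n
      exact with shape1-realize shape dec
      ... | t , all , dec′ = complete-exact {t = t} dec′ all

    shape2-minimal : ∀ H D j′ → IsMinIndex n j′ → Orbit H → Decomposes D H → Shape2 j′ D →
      MinInOrbit (completeMultipartite k n) H
    shape2-minimal H D j′ min′ orbit dec shape = orbit , λ H′ orbit′ →
      ≤-trans (≤-reflexive exact) (≤-trans (edges2-mono (min′ j))
        (≤-trans (≤-reflexive (sym (fkn-zero f≡0))) (edges1-lower H′ orbit′)))
      where
      exact : numEdges H ≡ edges2 k n j′
      exact with shape2-realize (z j′) shape dec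
      ... | t , spokes , tⱼ , dec′ = star-exact₂ {t = t} dec′ spokes tⱼ

theorem11 : (k : ℕ) → 3 ≤ k → (n : Fin k → ℕ) → (∀ i → 2 ≤ n i) →
    (j : Fin k) → IsMinIndex n j →
    ((G : Graph k n) → MinInOrbit (completeMultipartite k n) G →
    (D : SplitDec k n) → ValidDec D → Decomposes D G →
    ((k % 2 ≡ 0 → + 0 < fkn k (n j) → Shape1 D × numEdges G ≡ edges1 k n)
    × (k % 2 ≡ 0 → fkn k (n j) < + 0 →
    Σ (Fin k) λ j′ → IsMinIndex n j′ × Shape2 j′ D × numEdges G ≡ edges2 k n j′)
    × (k % 2 ≡ 1 →
    Σ (Fin k) λ j′ → IsMinIndex n j′ × Shape3 j′ D × numEdges G ≡ edges3 k n j′)))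
    × (k % 2 ≡ 0 → fkn k (n j) ≡ + 0 →
    (edges1 k n ≡ edges2 k n j)
    × ((H : Graph k n) → (D : SplitDec k n) → InOrbit (completeMultipartite k n) H →
    ValidDec D → Decomposes D H → Shape1 D → MinInOrbit (completeMultipartite k n) H)
    × ((H : Graph k n) → (D : SplitDec k n) → (j′ : Fin k) → IsMinIndex n j′ →
    InOrbit (completeMultipartite k n) H →
    ValidDec D → Decomposes D H → Shape2 j′ D → MinInOrbit (completeMultipartite k n) H)
    × (Σ (Graph k n) λ H → Σ (SplitDec k n) λ D →
    InOrbit (completeMultipartite k n) H × ValidDec D × Decomposes D H × Shape1 D)
    × (Σ (Graph k n) λ H → Σ (SplitDec k n) λ D →
    InOrbit (completeMultipartite k n) H × ValidDec D × Decomposes D H × Shape2 j D))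
theorem11 (suc K) (s≤s 2≤K) n 2≤n j min =
  (λ G minimal D valid dec → minimal-pos minimal valid dec ,
    minimal-neg minimal valid dec , minimal-odd minimal valid dec) ,
  λ even f≡0 → fkn-zero f≡0 ,
    (λ H D orbit _ → shape1-minimal even f≡0 H D orbit) ,
    (λ H D j′ min′ orbit _ → shape2-minimal even f≡0 H D j′ min′ orbit) ,
    witness₁ (attain₁ even) , witness₂ (attain₂ even)
  where
  open Optimum {n = n} 2≤K 2≤n {j} min
  witness₁ : (∃₂ λ H t → Orbit H × (∀ l → is-just (t l) ≡ true) × Decomposes (realize nothing t) H) →
    Σ (Graph (suc K) n) λ H → Σ (SplitDec (suc K) n) λ D →
      InOrbit (completeMultipartite (suc K) n) H × ValidDec D × Decomposes D H × Shape1 D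
  witness₁ (H , t , orbit , all , dec) = H , realize nothing t , orbit ,
    realize-valid nothing t , dec , realize-shape1 {t = t} all
  witness₂ : (∃₂ λ H t → Orbit H × AllSpokes j t × is-just (t j) ≡ true ×
      Decomposes (realize (just j) t) H) →
    Σ (Graph (suc K) n) λ H → Σ (SplitDec (suc K) n) λ D →
      InOrbit (completeMultipartite (suc K) n) H × ValidDec D × Decomposes D H × Shape2 j D
  witness₂ (H , t , orbit , spokes , tⱼ , dec) = H , realize (just j) t , orbit ,
    realize-valid (just j) t , dec , realize-shape2 {t = t} spokes tⱼ
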